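{- There is an absolute constant $C>0$ such that for every integer $r\geq 2$ and every sufficiently large even integer $n$ (i.e. $n\geq n_0(r)$), there exists a bipartite graph $G$ with at most $C\,r^{120}(\ln^2 r)\,n$ edges such that $G\longrightarrow_{1/r}C_n$.
   Context: For graphs $G,H$ and a real $0<\gamma<1$, we write $G\longrightarrow_{\gamma}H$ if every subgraph $J$ of $G$ with $e(J)\geq\gamma\, e(G)$ contains a copy of $H$ as a subgraph; here $e(\cdot)$ is the number of edges. $C_n$ denotes the cycle on $n$ vertices. -}

module Defs where

open import Data.Nat using (ℕ; zero; suc; _*_; _≤_; _<ᵇ_)
open import Data.Bool using (Bool; true; false; if_then_else_; _∧_)
open import Data.Fin using (Fin; toℕ; inject₁; fromℕ) renaming (zero to fzero; suc to fsuc)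
open import Data.List using (map; allFin)
open import Data.Nat.ListAction using (sum)
open import Data.Product using (Σ; _×_)
open import Data.Empty using (⊥)
open import Function.Definitions using (Injective)
open import Relation.Binary.PropositionalEquality using (_≡_)
open import Relation.Nullary using (¬_)

record Graph (m : ℕ) : Set where
  field
    adj   : Fin m → Fin m → Bool
    sym   : ∀ i j → adj i j ≡ adj j i
    irrefl : ∀ i → adj i i ≡ false
open Graph public

edgeCount : ∀ {m} → Graph m → ℕ
edgeCount {m} G =
  sum (map (λ i → sum (map (λ j → if (toℕ i <ᵇ toℕ j) ∧ adj G i j then 1 else 0)
                            (allFin m)))
           (allFin m))

_⊆G_ : ∀ {m} → Graph m → Graph m → Set
J ⊆G G = ∀ i j → adj J i j ≡ true → adj G i j ≡ true

ContainsCycle : ∀ {m} → Graph m → ℕ → Set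
ContainsCycle G zero = ⊥
ContainsCycle {m} G (suc k) =
  Σ (Fin (suc k) → Fin m) λ f →
    Injective _≡_ _≡_ f ×
    (∀ (i : Fin k) → adj G (f (inject₁ i)) (f (fsuc i)) ≡ true) ×
    adj G (f (fromℕ k)) (f fzero) ≡ true

Bipartite : ∀ {m} → Graph m → Set
Bipartite {m} G = Σ (Fin m → Bool) λ c → ∀ i j → adj G i j ≡ true → ¬ (c i ≡ c j)

-- G →_{1/r} C_n : every subgraph J with e(J) ≥ (1/r) e(G) contains a copy of C_n.
-- (e(J) ≥ e(G)/r is written without division as e(G) ≤ r * e(J).)
Arrows : ∀ {m} → Graph m → (r n : ℕ) → Set
Arrows {m} G r n = ∀ (J : Graph m) → J ⊆G G → edgeCount G ≤ r * edgeCount J → ContainsCycle J n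

{-# OPTIONS --safe #-}
module Submission where

-- G is a blow-up of a sparse bipartite graph H, each left vertex being replaced by 2r vertices
-- and each right vertex by 4r² vertices. If J ⊆ G has density 1/r, averaging first over pairs in
-- the left clusters and then over pairs in the right clusters yields one pair per cluster such
-- that at least a 1/(8r⁴) proportion of the edges of H become copies of K₂,₂ in J. These edges
-- form a subgraph J′ of H, and a path with k edges in J′, being doubled in J, contains C₂ₖ. So it
-- remains to find long paths in dense subgraphs of H. For this H is chosen so that every set of
-- 2K vertices spans few edges (a random map, derandomised), where K > k; if depth-first search in
-- J′ finds no path on k + 1 vertices, it finds K vertices with at most K neighbours outside, so
-- that deleting them loses few edges, and iterating shows that J′ itself has few edges.

open import Defs hiding (sym)
open import Data.Bool using (Bool; true; false; if_then_else_; _∧_; not; T)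
open import Data.Fin using (Fin; toℕ; inject₁; fromℕ; _↑ˡ_; _↑ʳ_; combine; splitAt; quotient; remainder) renaming (zero to fzero; suc to fsuc)
import Data.Fin.Properties as Fin
open import Data.List using (List; []; _∷_; map; allFin; length; _++_; lookup; cartesianProduct)
open import Data.List.Properties using (map-tabulate; length-tabulate; map-++; map-cong; map-∘; length-++; length-map; ++-assoc)
open import Data.List.Membership.Propositional using (_∈_)
open import Data.List.Membership.Propositional.Properties using (∈-lookup; ∈-++⁺ˡ; ∈-++⁺ʳ; ∈-map⁺; ∈-map⁻; ∈-cartesianProduct⁺)
open import Data.List.Relation.Binary.Disjoint.Propositional using (Disjoint)
open import Data.List.Relation.Binary.Permutation.Propositional using (_↭_; ↭-refl; ↭-sym; ↭-trans; ↭-reflexive; ↭⇒↭ₛ; prep; swap)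
import Data.List.Relation.Binary.Permutation.Propositional.Properties as Perm
import Data.List.Relation.Binary.Permutation.Setoid.Properties as PermSetoid
open import Data.List.Relation.Unary.All as All using (All; []; _∷_)
open import Data.List.Relation.Unary.AllPairs using ([]; _∷_)
open import Data.List.Relation.Unary.Any using (here; there)
open import Data.List.Relation.Unary.Linked using (Linked; []; [-]; _∷_)
open import Data.List.Relation.Unary.Unique.Propositional using (Unique)
import Data.List.Relation.Unary.Unique.Propositional.Properties as Unique
open import Data.Nat
open import Data.Nat.Divisibility using (_∣_; divides)
open import Data.Nat.ListAction using (sum)
open import Data.Nat.ListAction.Properties using (sum-++; sum-↭)
open import Data.Nat.Logarithm using (⌊log₂_⌋; ⌊log₂⌋-mono-≤)
open import Data.Nat.Properties
open import Data.Nat.Tactic.RingSolver using (solve-∀)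
open import Data.Product using (Σ; _×_; ∃; ∃-syntax; _,_; proj₁; proj₂)
open import Data.Sum using (_⊎_; inj₁; inj₂)
open import Data.Sum.Properties using (inj₁-injective; inj₂-injective; ≡-dec)
open import Data.Vec as Vec using (Vec; []; _∷_; tabulate)
open import Data.Vec.Properties using (lookup∘tabulate)
open import Function using (_∘_; id)
open import Relation.Binary.PropositionalEquality
open import Relation.Nullary using (Dec; yes; no; ⌊_⌋; contradiction)

-- The cycle must have exactly `n` vertices, whereas a density argument by itself yields long cycles
-- of uncontrolled length. Depth-first search changes its path by one vertex at a time, so it can
-- stop at exactly the wanted number of vertices, and doubling turns exact path lengths into exact
-- even cycle lengths. The cluster sizes differ because each is twice the inverse density at the
-- moment when pairs are picked in it. This is `r` on the left. Picking the left pairs lowers the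
-- density to `1/(2r²)`, so the right clusters need `4r²` vertices; picking there gives
-- `2(2r²)² = 8r⁴`. All these losses depend on `r` alone, so it is enough that the base graph has
-- linearly many edges in `k` and that its long paths survive in every subgraph of density
-- `1/(8r⁴)`.

private variable
  A B : Set

-- Finite sums

∑ : List A → (A → ℕ) → ℕ
∑ xs f = sum (map f xs)

∑-cong : ∀ (xs : List A) {f g : A → ℕ} → (∀ x → f x ≡ g x) → ∑ xs f ≡ ∑ xs g
∑-cong xs eq = cong sum (map-cong eq xs)

∑-mono : ∀ (xs : List A) {f g : A → ℕ} → (∀ x → f x ≤ g x) → ∑ xs f ≤ ∑ xs g
∑-mono []       le = z≤n
∑-mono (x ∷ xs) le = +-mono-≤ (le x) (∑-mono xs le)

∑-zero : ∀ (xs : List A) → ∑ xs (λ _ → 0) ≡ 0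
∑-zero []       = refl
∑-zero (x ∷ xs) = ∑-zero xs

∑-const : ∀ (xs : List A) c → ∑ xs (λ _ → c) ≡ length xs * c
∑-const []       c = refl
∑-const (x ∷ xs) c = cong (c +_) (∑-const xs c)

∑-+ : ∀ (xs : List A) (f g : A → ℕ) → ∑ xs (λ x → f x + g x) ≡ ∑ xs f + ∑ xs g
∑-+ []       f g = refl
∑-+ (x ∷ xs) f g = trans (cong (f x + g x +_) (∑-+ xs f g))
                         (interchange (f x) (g x) (∑ xs f) (∑ xs g))
  where
  interchange : ∀ a b c d → a + b + (c + d) ≡ a + c + (b + d)
  interchange = solve-∀

∑-*ˡ : ∀ (xs : List A) c (f : A → ℕ) → ∑ xs (λ x → c * f x) ≡ c * ∑ xs f
∑-*ˡ []       c f = sym (*-zeroʳ c)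
∑-*ˡ (x ∷ xs) c f = trans (cong (c * f x +_) (∑-*ˡ xs c f)) (sym (*-distribˡ-+ c (f x) _))

∑-*ʳ : ∀ (xs : List A) c (f : A → ℕ) → ∑ xs (λ x → f x * c) ≡ ∑ xs f * c
∑-*ʳ xs c f = trans (∑-cong xs λ x → *-comm (f x) c) (trans (∑-*ˡ xs c f) (*-comm c _))

∑-swap : ∀ (xs : List A) (ys : List B) (f : A → B → ℕ) →
         ∑ xs (λ x → ∑ ys (f x)) ≡ ∑ ys (λ y → ∑ xs (λ x → f x y))
∑-swap []       ys f = sym (∑-zero ys)
∑-swap (x ∷ xs) ys f = trans (cong (∑ ys (f x) +_) (∑-swap xs ys f)) (sym (∑-+ ys (f x) _))

∑-++ : ∀ (xs ys : List A) f → ∑ (xs ++ ys) f ≡ ∑ xs f + ∑ ys f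
∑-++ xs ys f = trans (cong sum (map-++ f xs ys)) (sum-++ (map f xs) (map f ys))

∑-map : ∀ (xs : List A) (g : A → B) f → ∑ (map g xs) f ≡ ∑ xs (f ∘ g)
∑-map xs g f = cong sum (sym (map-∘ xs))

∑-↭ : ∀ {xs ys : List A} f → xs ↭ ys → ∑ xs f ≡ ∑ ys f
∑-↭ f p = sum-↭ (Perm.map⁺ f p)

∑-∈ : ∀ {xs : List A} {x} f → x ∈ xs → f x ≤ ∑ xs f
∑-∈ {xs = x ∷ xs} f (here refl) = m≤m+n (f x) _
∑-∈ {xs = y ∷ xs} f (there p)   = ≤-trans (∑-∈ f p) (m≤n+m _ (f y))

∑-product : ∀ (xs : List A) (ys : List B) (f : A → ℕ) (g : B → ℕ) →
            ∑ xs (λ x → ∑ ys (λ y → f x * g y)) ≡ ∑ xs f * ∑ ys g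
∑-product xs ys f g = trans (∑-cong xs λ x → ∑-*ˡ ys (f x) g) (∑-*ʳ xs (∑ ys g) f)

∑-suc : ∀ {n} (f : Fin (suc n) → ℕ) → ∑ (allFin (suc n)) f ≡ f fzero + ∑ (allFin n) (f ∘ fsuc)
∑-suc {n} f = cong (λ l → f fzero + sum l)
  (trans (map-tabulate fsuc f) (sym (map-tabulate id (f ∘ fsuc))))

∑-split : ∀ a {b} (f : Fin (a + b) → ℕ) →
          ∑ (allFin (a + b)) f ≡ ∑ (allFin a) (λ i → f (i ↑ˡ b)) + ∑ (allFin b) (λ j → f (a ↑ʳ j))
∑-split zero    f = refl
∑-split (suc a) {b} f = begin
  ∑ (allFin (suc a + b)) f
    ≡⟨ ∑-suc f ⟩
  f fzero + ∑ (allFin (a + b)) (f ∘ fsuc)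
    ≡⟨ cong (f fzero +_) (∑-split a (f ∘ fsuc)) ⟩
  f fzero + (∑ (allFin a) (λ i → f (fsuc (i ↑ˡ b))) + ∑ (allFin b) (λ j → f (fsuc (a ↑ʳ j))))
    ≡⟨ +-assoc (f fzero) _ _ ⟨
  f fzero + ∑ (allFin a) (λ i → f (fsuc (i ↑ˡ b))) + ∑ (allFin b) (λ j → f (fsuc (a ↑ʳ j)))
    ≡⟨ cong (_+ ∑ (allFin b) (λ j → f (suc a ↑ʳ j))) (∑-suc (λ i → f (i ↑ˡ b))) ⟨
  ∑ (allFin (suc a)) (λ i → f (i ↑ˡ b)) + ∑ (allFin b) (λ j → f (suc a ↑ʳ j)) ∎
  where open ≡-Reasoning

∑-combine : ∀ a {b} (f : Fin (a * b) → ℕ) →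
            ∑ (allFin (a * b)) f ≡ ∑ (allFin a) (λ i → ∑ (allFin b) (λ j → f (combine i j)))
∑-combine zero    f = refl
∑-combine (suc a) {b} f = begin
  ∑ (allFin (b + a * b)) f
    ≡⟨ ∑-split b f ⟩
  ∑ (allFin b) (λ j → f (j ↑ˡ (a * b))) + ∑ (allFin (a * b)) (λ k → f (b ↑ʳ k))
    ≡⟨ cong (∑ (allFin b) (λ j → f (j ↑ˡ (a * b))) +_) (∑-combine a (λ k → f (b ↑ʳ k))) ⟩
  ∑ (allFin b) (λ j → f (j ↑ˡ (a * b))) + ∑ (allFin a) (λ i → ∑ (allFin b) (λ j → f (b ↑ʳ combine i j)))
    ≡⟨ ∑-suc (λ (i : Fin (suc a)) → ∑ (allFin b) (λ j → f (combine i j))) ⟨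
  ∑ (allFin (suc a)) (λ i → ∑ (allFin b) (λ j → f (combine i j))) ∎
  where open ≡-Reasoning

length-allFin : ∀ n → length (allFin n) ≡ n
length-allFin n = length-tabulate {n = n} id

∑-constFin : ∀ n c → ∑ (allFin n) (λ _ → c) ≡ n * c
∑-constFin n c = trans (∑-const (allFin n) c) (cong (_* c) (length-allFin n))

∑-max : ∀ {n} (f : Fin (suc n) → ℕ) → ∃[ i ] ∑ (allFin (suc n)) f ≤ suc n * f i
∑-max {zero}  f = fzero , ≤-refl
∑-max {suc n} f with ∑-max (f ∘ fsuc)
... | i , le with ≤-total (f fzero) (f (fsuc i))
... | inj₁ p = fsuc i , ≤-trans (≤-reflexive (∑-suc f)) (+-mono-≤ p le)
... | inj₂ p = fzero , ≤-trans (≤-reflexive (∑-suc f)) (+-monoʳ-≤ (f fzero) (≤-trans le (*-monoʳ-≤ (suc n) p)))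

∑-min : ∀ {n} (f : Fin (suc n) → ℕ) → ∃[ i ] suc n * f i ≤ ∑ (allFin (suc n)) f
∑-min {zero}  f = fzero , ≤-refl
∑-min {suc n} f with ∑-min (f ∘ fsuc)
... | i , le with ≤-total (f fzero) (f (fsuc i))
... | inj₁ p = fzero , ≤-trans (+-monoʳ-≤ (f fzero) (≤-trans (*-monoʳ-≤ (suc n) p) le)) (≤-reflexive (sym (∑-suc f)))
... | inj₂ p = fsuc i , ≤-trans (+-mono-≤ p le) (≤-reflexive (sym (∑-suc f)))

𝟙 : Bool → ℕ
𝟙 b = if b then 1 else 0

𝟙≤1 : ∀ b → 𝟙 b ≤ 1
𝟙≤1 true  = ≤-refl
𝟙≤1 false = z≤n

δ : ∀ {n} → Fin n → Fin n → ℕ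
δ i j = 𝟙 ⌊ i Fin.≟ j ⌋

δ-suc : ∀ {n} (i j : Fin n) → δ (fsuc i) (fsuc j) ≡ δ i j
δ-suc i j with i Fin.≟ j
... | yes _ = refl
... | no  _ = refl

δ≢ : ∀ {n} {i j : Fin n} → i ≢ j → δ i j ≡ 0
δ≢ {i = i} {j} i≢j with i Fin.≟ j
... | yes i≡j = contradiction i≡j i≢j
... | no _ = refl

∑-δ : ∀ {n} (i : Fin n) (f : Fin n → ℕ) → ∑ (allFin n) (λ j → δ i j * f j) ≡ f i
∑-δ {suc n} fzero    f = trans (∑-suc (λ j → δ fzero j * f j))
  (trans (cong₂ _+_ (+-identityʳ (f fzero)) (∑-zero (allFin n))) (+-identityʳ _))
∑-δ {suc n} (fsuc i) f = trans (∑-suc (λ j → δ (fsuc i) j * f j))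
  (trans (∑-cong (allFin n) λ j → cong (_* f (fsuc j)) (δ-suc i j)) (∑-δ i (f ∘ fsuc)))

-- Choosing pairs in clusters

𝟙-∧ : ∀ a b → 𝟙 (a ∧ b) ≡ 𝟙 a * 𝟙 b
𝟙-∧ true  b = sym (+-identityʳ (𝟙 b))
𝟙-∧ false b = refl

𝟙-idem : ∀ a → 𝟙 a * 𝟙 a ≡ 𝟙 a
𝟙-idem true  = refl
𝟙-idem false = refl

ν : ∀ {n} → Fin n → Fin n → ℕ
ν i j = 𝟙 (not ⌊ i Fin.≟ j ⌋)

ν+δ : ∀ {n} (i j : Fin n) → ν i j + δ i j ≡ 1
ν+δ i j with i Fin.≟ j
... | yes _ = refl
... | no  _ = refl

ν-refl : ∀ {n} (i : Fin n) → ν i i ≡ 0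
ν-refl i with i Fin.≟ i
... | yes _  = refl
... | no i≢i with () ← i≢i refl

ν≤1 : ∀ {n} (i j : Fin n) → ν i j ≤ 1
ν≤1 i j = 𝟙≤1 _

distinct-pairs : ∀ {b} (a : Fin b → Bool) →
  ∑ (allFin b) (λ x → ∑ (allFin b) (λ y → ν x y * (𝟙 (a x) * 𝟙 (a y)))) + ∑ (allFin b) (𝟙 ∘ a)
  ≡ ∑ (allFin b) (𝟙 ∘ a) * ∑ (allFin b) (𝟙 ∘ a)
distinct-pairs {b} a = begin
  ∑ F (λ x → ∑ F (λ y → ν x y * (𝟙 (a x) * 𝟙 (a y)))) + ∑ F (𝟙 ∘ a)
    ≡⟨ ∑-+ F _ (𝟙 ∘ a) ⟨
  ∑ F (λ x → ∑ F (λ y → ν x y * (𝟙 (a x) * 𝟙 (a y))) + 𝟙 (a x))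
    ≡⟨ ∑-cong F row ⟩
  ∑ F (λ x → ∑ F (λ y → 𝟙 (a x) * 𝟙 (a y)))
    ≡⟨ ∑-product F F (𝟙 ∘ a) (𝟙 ∘ a) ⟩
  ∑ F (𝟙 ∘ a) * ∑ F (𝟙 ∘ a) ∎
  where
  open ≡-Reasoning
  F = allFin b
  row : ∀ x → ∑ F (λ y → ν x y * (𝟙 (a x) * 𝟙 (a y))) + 𝟙 (a x) ≡ ∑ F (λ y → 𝟙 (a x) * 𝟙 (a y))
  row x = begin
    ∑ F (λ y → ν x y * (𝟙 (a x) * 𝟙 (a y))) + 𝟙 (a x)
      ≡⟨ cong (∑ F (λ y → ν x y * (𝟙 (a x) * 𝟙 (a y))) +_)
              (trans (sym (𝟙-idem (a x))) (sym (∑-δ x (λ y → 𝟙 (a x) * 𝟙 (a y))))) ⟩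
    ∑ F (λ y → ν x y * (𝟙 (a x) * 𝟙 (a y))) + ∑ F (λ y → δ x y * (𝟙 (a x) * 𝟙 (a y)))
      ≡⟨ ∑-+ F _ _ ⟨
    ∑ F (λ y → ν x y * (𝟙 (a x) * 𝟙 (a y)) + δ x y * (𝟙 (a x) * 𝟙 (a y)))
      ≡⟨ ∑-cong F (λ y → trans (sym (*-distribʳ-+ (𝟙 (a x) * 𝟙 (a y)) (ν x y) (δ x y)))
                               (trans (cong (_* (𝟙 (a x) * 𝟙 (a y))) (ν+δ x y)) (*-identityˡ _))) ⟩
    ∑ F (λ y → 𝟙 (a x) * 𝟙 (a y)) ∎

2c≤c[c-1]+2 : ∀ c P → P + c ≡ c * c → 2 * c ≤ P + 2
2c≤c[c-1]+2 zero          P eq = z≤n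
2c≤c[c-1]+2 (suc zero)    P eq = m≤n+m 2 P
2c≤c[c-1]+2 (suc (suc c)) P eq = +-cancelʳ-≤ (2 + c) _ _ (begin
  2 * (2 + c) + (2 + c)                 ≤⟨ m≤m+n _ (c * c + c) ⟩
  2 * (2 + c) + (2 + c) + (c * c + c)   ≡⟨ expand c ⟩
  (2 + c) * (2 + c) + 2                 ≡⟨ cong (_+ 2) eq ⟨
  P + (2 + c) + 2                       ≡⟨ shuffle P (2 + c) ⟩
  P + 2 + (2 + c)                       ∎)
  where
  open ≤-Reasoning
  expand : ∀ c → 2 * (2 + c) + (2 + c) + (c * c + c) ≡ (2 + c) * (2 + c) + 2
  expand = solve-∀
  shuffle : ∀ P d → P + d + 2 ≡ P + 2 + d
  shuffle = solve-∀

-- From `(c - 1)(c - 2) ≥ 0`: a column with `c` hits has `c(c - 1) ≥ 2c - 2` ordered pairs of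
-- distinct hits. Being linear in `c`, the bound can be summed over columns with no appeal to
-- convexity. The loss of 2 is charged only where `e` is true, since other columns have no hits.
column-bound : ∀ {b} (a : Fin b → Bool) e → (∀ x → a x ≡ true → e ≡ true) →
  2 * ∑ (allFin b) (𝟙 ∘ a)
  ≤ ∑ (allFin b) (λ x → ∑ (allFin b) (λ y → ν x y * (𝟙 (a x) * 𝟙 (a y)))) + 2 * 𝟙 e
column-bound {b} a true  _   = 2c≤c[c-1]+2 _ _ (distinct-pairs a)
column-bound {b} a false a⇒e = ≤-trans (≤-reflexive (cong (2 *_) none)) z≤n
  where
  false-everywhere : ∀ x → 𝟙 (a x) ≡ 0
  false-everywhere x with a x in eq
  ... | false = refl
  ... | true with () ← a⇒e x eq
  none : ∑ (allFin b) (𝟙 ∘ a) ≡ 0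
  none = trans (∑-cong (allFin b) false-everywhere) (∑-zero (allFin b))

-- Sum `column-bound` over all columns, then take the best of the `b * b` ordered pairs.
good-pair : ∀ {b} → 2 ≤ b → (ts : List A) (R : Fin b → A → Bool) (E : A → Bool) →
  (∀ x t → R x t ≡ true → E t ≡ true) →
  ∃[ x ] ∃[ y ] x ≢ y ×
    2 * ∑ (allFin b) (λ x → ∑ ts (λ t → 𝟙 (R x t)))
    ≤ b * (b * ∑ ts (λ t → 𝟙 (R x t ∧ R y t))) + 2 * ∑ ts (𝟙 ∘ E)
good-pair {b = suc zero} (s≤s ()) ts R E R⇒E
good-pair {b = suc (suc b′)} _ ts R E R⇒E = conclude
  where
  open ≤-Reasoning
  b = suc (suc b′)
  F = allFin b
  codeg : Fin b → Fin b → ℕ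
  codeg x y = ∑ ts (λ t → 𝟙 (R x t ∧ R y t))
  g : Fin b → Fin b → ℕ
  g x y = ν x y * codeg x y

  total : 2 * ∑ F (λ x → ∑ ts (λ t → 𝟙 (R x t))) ≤ ∑ F (λ x → ∑ F (g x)) + 2 * ∑ ts (𝟙 ∘ E)
  total = begin
    2 * ∑ F (λ x → ∑ ts (λ t → 𝟙 (R x t)))
      ≡⟨ cong (2 *_) (∑-swap F ts _) ⟩
    2 * ∑ ts (λ t → ∑ F (λ x → 𝟙 (R x t)))
      ≡⟨ ∑-*ˡ ts 2 _ ⟨
    ∑ ts (λ t → 2 * ∑ F (λ x → 𝟙 (R x t)))
      ≤⟨ ∑-mono ts (λ t → column-bound (λ x → R x t) (E t) (λ x → R⇒E x t)) ⟩
    ∑ ts (λ t → ∑ F (λ x → ∑ F (λ y → ν x y * (𝟙 (R x t) * 𝟙 (R y t)))) + 2 * 𝟙 (E t))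
      ≡⟨ ∑-+ ts _ _ ⟩
    ∑ ts (λ t → ∑ F (λ x → ∑ F (λ y → ν x y * (𝟙 (R x t) * 𝟙 (R y t))))) + ∑ ts (λ t → 2 * 𝟙 (E t))
      ≡⟨ cong₂ _+_ (∑-swap ts F _) (∑-*ˡ ts 2 (𝟙 ∘ E)) ⟩
    ∑ F (λ x → ∑ ts (λ t → ∑ F (λ y → ν x y * (𝟙 (R x t) * 𝟙 (R y t))))) + 2 * ∑ ts (𝟙 ∘ E)
      ≡⟨ cong (_+ 2 * ∑ ts (𝟙 ∘ E)) (∑-cong F λ x → trans (∑-swap ts F _) (∑-cong F λ y →
           trans (∑-*ˡ ts (ν x y) _) (cong (ν x y *_) (∑-cong ts λ t → sym (𝟙-∧ (R x t) (R y t)))))) ⟩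
    ∑ F (λ x → ∑ F (g x)) + 2 * ∑ ts (𝟙 ∘ E) ∎

  Goal : Set
  Goal = ∃[ x ] ∃[ y ] x ≢ y ×
    2 * ∑ F (λ x → ∑ ts (λ t → 𝟙 (R x t))) ≤ b * (b * codeg x y) + 2 * ∑ ts (𝟙 ∘ E)

  separate : ∀ x y → ∑ F (λ x → ∑ F (g x)) ≤ b * (b * g x y) → Dec (x ≡ y) → Goal
  separate x y le (no x≢y) = x , y , x≢y , ≤-trans total (+-monoˡ-≤ _ (begin
    ∑ F (λ x → ∑ F (g x))     ≤⟨ le ⟩
    b * (b * g x y)           ≤⟨ *-monoʳ-≤ b (*-monoʳ-≤ b (*-monoˡ-≤ (codeg x y) (ν≤1 x y))) ⟩
    b * (b * (1 * codeg x y)) ≡⟨ cong (λ z → b * (b * z)) (*-identityˡ (codeg x y)) ⟩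
    b * (b * codeg x y)       ∎))
  -- If the maximum sits on the diagonal, the factor `ν` makes it 0, so the whole sum vanishes and
  -- any two distinct elements will do.
  separate x .x le (yes refl) = fzero , fsuc fzero , (λ ()) , ≤-trans total (+-monoˡ-≤ _ (begin
    ∑ F (λ x → ∑ F (g x))              ≤⟨ le ⟩
    b * (b * g x x)                    ≡⟨ cong (λ z → b * (b * (z * codeg x x))) (ν-refl x) ⟩
    b * (b * 0)                        ≡⟨ trans (cong (b *_) (*-zeroʳ b)) (*-zeroʳ b) ⟩
    0                                  ≤⟨ z≤n ⟩
    b * (b * codeg fzero (fsuc fzero)) ∎))

  conclude : Goal
  conclude =
    let x , x-max = ∑-max (λ x → ∑ F (g x))
        y , y-max = ∑-max (g x)
    in separate x y (≤-trans x-max (*-monoʳ-≤ b y-max)) (x Fin.≟ y)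

-- Density `1/p` in clusters of size `2p` means that a pair in `E` carries two hits of `R` on
-- average. Summing the bounds of `good-pair` then gives `4e ≤ (2p)² s + 2e`, with `s` the sum of
-- the codegrees of the chosen pairs: the loss term consumes only half of the left side.
pairing : ∀ {A B : Set} (us : List A) (ts : List B) p .{{_ : NonZero p}}
  (E : A → B → Bool) (R : A → Fin (2 * p) → B → Bool) →
  (∀ u x t → R u x t ≡ true → E u t ≡ true) →
  2 * p * ∑ us (λ u → ∑ ts (λ t → 𝟙 (E u t)))
    ≤ p * ∑ us (λ u → ∑ (allFin (2 * p)) (λ x → ∑ ts (λ t → 𝟙 (R u x t)))) →
  Σ (A → Fin (2 * p)) λ x → Σ (A → Fin (2 * p)) λ y → (∀ u → x u ≢ y u) ×
    ∑ us (λ u → ∑ ts (λ t → 𝟙 (E u t)))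
    ≤ 2 * (p * p) * ∑ us (λ u → ∑ ts (λ t → 𝟙 (R u (x u) t ∧ R u (y u) t)))
pairing {A = A} us ts p E R R⇒E dense =
  (λ u → proj₁ (pick u)) , (λ u → proj₁ (proj₂ (pick u))) , (λ u → proj₁ (proj₂ (proj₂ (pick u)))) ,
  *-cancelˡ-≤ 2 (+-cancelʳ-≤ (2 * e) (2 * e) _ (begin
    2 * e + 2 * e                   ≡⟨ *-distribˡ-+ 2 e e ⟨
    2 * (e + e)                     ≡⟨ cong (λ z → 2 * (e + z)) (+-identityʳ e) ⟨
    2 * (2 * e)                     ≤⟨ *-monoʳ-≤ 2 2e≤j ⟩
    2 * j                           ≡⟨ ∑-*ˡ us 2 _ ⟨
    ∑ us (λ u → 2 * deg u)          ≤⟨ ∑-mono us (λ u → proj₂ (proj₂ (proj₂ (pick u)))) ⟩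
    ∑ us (λ u → b * (b * c u) + 2 * ∑ ts (λ t → 𝟙 (E u t)))
      ≡⟨ ∑-+ us _ _ ⟩
    ∑ us (λ u → b * (b * c u)) + ∑ us (λ u → 2 * ∑ ts (λ t → 𝟙 (E u t)))
      ≡⟨ cong₂ _+_ (trans (∑-*ˡ us b _) (cong (b *_) (∑-*ˡ us b c))) (∑-*ˡ us 2 _) ⟩
    b * (b * ∑ us c) + 2 * e        ≡⟨ cong (_+ 2 * e) (regroup p (∑ us c)) ⟩
    2 * (2 * (p * p) * ∑ us c) + 2 * e ∎))
  where
  open ≤-Reasoning
  b = 2 * p
  e = ∑ us (λ u → ∑ ts (λ t → 𝟙 (E u t)))
  deg : A → ℕ
  deg u = ∑ (allFin b) (λ x → ∑ ts (λ t → 𝟙 (R u x t)))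
  j = ∑ us deg
  2e≤j : 2 * e ≤ j
  2e≤j = *-cancelˡ-≤ p (≤-trans (≤-reflexive (move p e)) dense)
    where
    move : ∀ p e → p * (2 * e) ≡ 2 * p * e
    move = solve-∀
  pick : ∀ u → ∃[ x ] ∃[ y ] x ≢ y ×
    2 * deg u ≤ b * (b * ∑ ts (λ t → 𝟙 (R u x t ∧ R u y t))) + 2 * ∑ ts (λ t → 𝟙 (E u t))
  pick u = good-pair (*-monoʳ-≤ 2 (>-nonZero⁻¹ p)) ts (R u) (E u) (R⇒E u)
  c : A → ℕ
  c u = ∑ ts (λ t → 𝟙 (R u (proj₁ (pick u)) t ∧ R u (proj₁ (proj₂ (pick u))) t))
  regroup : ∀ p s → 2 * p * (2 * p * s) ≡ 2 * (2 * (p * p) * s)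
  regroup = solve-∀

-- Long paths by depth-first search

Unique-↭ : ∀ {xs ys : List A} → xs ↭ ys → Unique xs → Unique ys
Unique-↭ p = PermSetoid.Unique-resp-↭ (setoid _) (↭⇒↭ₛ p)

Unique-++⁻ʳ : ∀ (xs : List A) {ys} → Unique (xs ++ ys) → Unique ys
Unique-++⁻ʳ []       u       = u
Unique-++⁻ʳ (x ∷ xs) (_ ∷ u) = Unique-++⁻ʳ xs u

module DepthFirst {V : Set} (adj : V → V → Bool) (adj-sym : ∀ x y → adj x y ≡ adj y x) where

  -- Counts ordered pairs, so an edge inside xs contributes 2 to edges xs xs.
  edges : List V → List V → ℕ
  edges xs ys = ∑ xs (λ x → ∑ ys (λ y → 𝟙 (adj x y)))

  edges-++ˡ : ∀ xs ys zs → edges (xs ++ ys) zs ≡ edges xs zs + edges ys zs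
  edges-++ˡ xs ys zs = ∑-++ xs ys _

  edges-sym : ∀ xs ys → edges xs ys ≡ edges ys xs
  edges-sym xs ys = trans (∑-swap xs ys _) (∑-cong ys λ y → ∑-cong xs λ x → cong 𝟙 (adj-sym x y))

  edges-++ʳ : ∀ xs ys zs → edges xs (ys ++ zs) ≡ edges xs ys + edges xs zs
  edges-++ʳ xs ys zs = trans (∑-cong xs λ x → ∑-++ ys zs _) (∑-+ xs _ _)

  edges-↭ʳ : ∀ xs {ys zs} → ys ↭ zs → edges xs ys ≡ edges xs zs
  edges-↭ʳ xs p = ∑-cong xs λ x → ∑-↭ _ p

  edges-↭ : ∀ {xs ys} → xs ↭ ys → edges xs xs ≡ edges ys ys
  edges-↭ {xs} p = trans (edges-↭ʳ xs p) (∑-↭ _ p)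

  Path : ℕ → Set
  Path ℓ = Σ (List V) λ ps → length ps ≡ ℓ × Unique ps × Linked (λ x y → adj x y ≡ true) ps

  Separation : ℕ → ℕ → List V → Set
  Separation K ℓ W = Σ (List V) λ D → Σ (List V) λ P → Σ (List V) λ U →
    D ++ P ++ U ↭ W × length D ≡ K × length P ≤ ℓ × edges D U ≡ 0

  neighbour? : ∀ p U → (Σ V λ u → Σ (List V) λ U′ → U ↭ u ∷ U′ × adj p u ≡ true)
                     ⊎ ∑ U (λ u → 𝟙 (adj p u)) ≡ 0
  neighbour? p []       = inj₂ refl
  neighbour? p (u ∷ U) with adj p u in eq
  ... | true  = inj₁ (u , U , ↭-refl , eq)
  ... | false with neighbour? p U
  ...   | inj₁ (u′ , U′ , U↭ , a) = inj₁ (u′ , u ∷ U′ , ↭-trans (prep u U↭) (swap u u′ ↭-refl) , a)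
  ...   | inj₂ none = inj₂ none

  -- D holds the vertices from which the search has backtracked, P the current path (tip first)
  -- and U the unvisited vertices.
  search : ∀ {K ℓ W} → Unique W → K ≤ length W → ∀ fuel D P U → D ++ P ++ U ↭ W →
           length D ≤ K → length P ≤ ℓ → edges D U ≡ 0 → Linked (λ x y → adj x y ≡ true) P →
           length U + length U + length P < fuel → Path ℓ ⊎ Separation K ℓ W
  -- The fuel bounds `2|U| + |P|`, which drops by one both when a vertex moves from `U` to `P` and
  -- when the tip of `P` moves to `D`.
  search {K} {ℓ} uW K≤W (suc fuel) D P U D+P+U↭W D≤K P≤ℓ DU≡0 linked (s≤s m≤fuel)
    with length D ≟ K | length P ≟ ℓ
  ... | yes D≡K | _ = inj₂ (D , P , U , D+P+U↭W , D≡K , P≤ℓ , DU≡0)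
  ... | no _ | yes P≡ℓ = inj₁ (P , P≡ℓ , Unique-++⁻ʳ (D ++ U) uP , linked)
    where
    uP : Unique ((D ++ U) ++ P)
    uP = Unique-↭ (↭-trans (↭-sym D+P+U↭W)
           (↭-trans (Perm.++⁺ˡ D (Perm.++-comm P U)) (↭-reflexive (sym (++-assoc D U P))))) uW
  -- Here `D` has absorbed all of `W`, hence at least `K` vertices, so the search would have stopped
  -- before.
  search {K} {ℓ} uW K≤W (suc fuel) D [] [] D↭W D≤K P≤ℓ DU≡0 linked (s≤s m≤fuel)
    | no D≢K | no P≢ℓ = contradiction
      (≤-antisym D≤K (≤-trans K≤W (≤-reflexive (trans (sym (Perm.↭-length D↭W)) D+0))))
      D≢K
    where
    D+0 : length (D ++ []) ≡ length D
    D+0 = trans (length-++ D) (+-identityʳ _)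
  search uW K≤W (suc fuel) D [] (u ∷ U) D+P+U↭W D≤K P≤ℓ DU≡0 linked (s≤s m≤fuel)
    | no D≢K | no P≢ℓ =
    search uW K≤W fuel D (u ∷ []) U D+P+U↭W D≤K (≤∧≢⇒< P≤ℓ P≢ℓ)
      (m+n≡0⇒n≡0 (edges D (u ∷ [])) (trans (sym (edges-++ʳ D (u ∷ []) U)) DU≡0))
      [-] (≤-trans (≤-reflexive (measure (length U))) m≤fuel)
    where
    measure : ∀ a → suc (a + a + 1) ≡ suc a + suc a + 0
    measure = solve-∀
  search {K} {ℓ} {W} uW K≤W (suc fuel) D (p ∷ P) U D+P+U↭W D≤K P≤ℓ DU≡0 linked (s≤s m≤fuel)
    | no D≢K | no P≢ℓ with neighbour? p U
  ... | inj₁ (u , U′ , U↭u∷U′ , pu) =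
    search uW K≤W fuel D (u ∷ p ∷ P) U′ perm D≤K (≤∧≢⇒< P≤ℓ P≢ℓ)
      (m+n≡0⇒n≡0 (edges D (u ∷ [])) (trans (sym (edges-++ʳ D (u ∷ []) U′))
        (trans (sym (edges-↭ʳ D U↭u∷U′)) DU≡0)))
      (trans (adj-sym u p) pu ∷ linked)
      (≤-trans (≤-reflexive (trans (measure (length U′) (length P))
        (cong (λ l → l + l + suc (length P)) (sym (Perm.↭-length U↭u∷U′))))) m≤fuel)
    where
    perm : D ++ u ∷ p ∷ P ++ U′ ↭ W
    perm = ↭-trans (Perm.++⁺ˡ D (↭-sym (↭-trans (Perm.++⁺ˡ (p ∷ P) U↭u∷U′)
             (Perm.shift u (p ∷ P) U′)))) D+P+U↭W
    measure : ∀ a b → suc (a + a + suc (suc b)) ≡ suc a + suc a + suc b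
    measure = solve-∀
  ... | inj₂ none =
    search uW K≤W fuel (p ∷ D) P U (↭-trans (↭-sym (Perm.shift p D (P ++ U))) D+P+U↭W)
      (≤∧≢⇒< D≤K D≢K) (≤-trans (n≤1+n _) P≤ℓ) (cong₂ _+_ none DU≡0) (tail linked)
      (≤-trans (≤-reflexive (sym (+-suc (length U + length U) (length P)))) m≤fuel)
    where
    tail : ∀ {xs x} → Linked (λ x y → adj x y ≡ true) (x ∷ xs) → Linked (λ x y → adj x y ≡ true) xs
    tail [-]     = []
    tail (_ ∷ l) = l

  module _ {K ℓ M : ℕ} (ℓ≤K : ℓ ≤ K)
           (sparse : ∀ Z → Unique Z → length Z ≤ 2 * K → edges Z Z ≤ M) where

    -- With no edges between `D` and `U`, all edges meeting `D` lie inside `D ++ P`. Edges inside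
    -- `P` are counted in both summands, whence an inequality.
    edges-peel : ∀ {D P U W} → D ++ P ++ U ↭ W → edges D U ≡ 0 →
                 edges W W ≤ edges (D ++ P) (D ++ P) + edges (P ++ U) (P ++ U)
    edges-peel {D} {P} {U} {W} perm DU≡0 = begin
      edges W W
        ≡⟨ edges-↭ perm ⟨
      edges (D ++ R) (D ++ R)
        ≡⟨ edges-++ˡ D R (D ++ R) ⟩
      edges D (D ++ R) + edges R (D ++ R)
        ≡⟨ cong₂ _+_ (edges-++ʳ D D R) (edges-++ʳ R D R) ⟩
      edges D D + edges D R + (edges R D + edges R R)
        ≡⟨ cong₂ (λ a b → edges D D + a + (b + edges R R)) DR (trans (edges-sym R D) DR) ⟩
      edges D D + edges D P + (edges D P + edges R R)
        ≡⟨ +-assoc (edges D D + edges D P) (edges D P) (edges R R) ⟨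
      edges D D + edges D P + edges D P + edges R R
        ≤⟨ +-monoˡ-≤ (edges R R) (+-monoʳ-≤ (edges D D + edges D P) (m≤m+n (edges D P) (edges P P))) ⟩
      edges D D + edges D P + (edges D P + edges P P) + edges R R
        ≡⟨ cong (_+ edges R R) (begin-equality
             edges D D + edges D P + (edges D P + edges P P)
               ≡⟨ cong (λ a → edges D D + edges D P + (a + edges P P)) (edges-sym D P) ⟩
             edges D D + edges D P + (edges P D + edges P P)
               ≡⟨ cong₂ _+_ (edges-++ʳ D D P) (edges-++ʳ P D P) ⟨
             edges D (D ++ P) + edges P (D ++ P)
               ≡⟨ edges-++ˡ D P (D ++ P) ⟨
             edges (D ++ P) (D ++ P) ∎) ⟩
      edges (D ++ P) (D ++ P) + edges R R ∎
      where
      open ≤-Reasoning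
      R = P ++ U
      DR : edges D R ≡ edges D P
      DR = trans (edges-++ʳ D P U) (trans (cong (edges D P +_) DU≡0) (+-identityʳ _))

    -- While there is no long path, the search yields K vertices all of whose edges lie inside
    -- a set of at most 2K vertices; deleting them costs at most M edges per K vertices.
    path-or-few-edges : 0 < K → ∀ fuel W → Unique W → length W ≤ fuel →
                        Path ℓ ⊎ K * edges W W ≤ M * (length W + K)
    path-or-few-edges 0<K fuel W uW W≤fuel with K ≤? length W
    -- Fewer than `K` vertices remain and are themselves a sparse set; the extra summand `K` in the
    -- bound pays for this last batch.
    ... | no K≰W = inj₂ (begin
      K * edges W W       ≤⟨ *-monoʳ-≤ K (sparse W uW (≤-trans (<⇒≤ (≰⇒> K≰W)) (m≤m+n K _))) ⟩
      K * M               ≡⟨ *-comm K M ⟩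
      M * K               ≤⟨ *-monoʳ-≤ M (m≤n+m K (length W)) ⟩
      M * (length W + K)  ∎)
      where open ≤-Reasoning
    path-or-few-edges 0<K zero W uW W≤0 | yes K≤W =
      contradiction (≤-trans 0<K (≤-trans K≤W W≤0)) λ ()
    path-or-few-edges 0<K (suc fuel) W uW W≤fuel | yes K≤W
      with search uW K≤W _ [] [] W ↭-refl z≤n z≤n refl [] ≤-refl
    ... | inj₁ path = inj₁ path
    ... | inj₂ (D , P , U , perm , D≡K , P≤ℓ , DU≡0)
      -- Only `D` is deleted. The path `P` stays, since its vertices may have neighbours in `U`.
      with path-or-few-edges 0<K fuel (P ++ U)
             (Unique-++⁻ʳ D (Unique-↭ (↭-sym perm) uW)) rest≤fuel
      where
      rest≤fuel : length (P ++ U) ≤ fuel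
      rest≤fuel = ≤-pred (begin
        suc (length (P ++ U))       ≤⟨ +-monoˡ-≤ (length (P ++ U)) 0<K ⟩
        K + length (P ++ U)         ≡⟨ cong (_+ length (P ++ U)) D≡K ⟨
        length D + length (P ++ U)  ≡⟨ length-++ D ⟨
        length (D ++ P ++ U)        ≡⟨ Perm.↭-length perm ⟩
        length W                    ≤⟨ W≤fuel ⟩
        suc fuel                    ∎)
        where open ≤-Reasoning
    ... | inj₁ path = inj₁ path
    ... | inj₂ few = inj₂ (begin
      K * edges W W
        ≤⟨ *-monoʳ-≤ K (edges-peel {D} {P} perm DU≡0) ⟩
      K * (edges (D ++ P) (D ++ P) + edges R R)
        ≡⟨ *-distribˡ-+ K _ _ ⟩
      K * edges (D ++ P) (D ++ P) + K * edges R R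
        ≤⟨ +-mono-≤ (*-monoʳ-≤ K (sparse (D ++ P) uDP DP≤2K)) few ⟩
      K * M + M * (length R + K)
        ≡⟨ regroup K M (length R) ⟩
      M * (K + length R + K)
        ≡⟨ cong (λ l → M * (l + K)) (trans (cong (_+ length R) (sym D≡K))
             (trans (sym (length-++ D)) (Perm.↭-length perm))) ⟩
      M * (length W + K) ∎)
      where
      open ≤-Reasoning
      R = P ++ U
      regroup : ∀ K M r → K * M + M * (r + K) ≡ M * (K + r + K)
      regroup = solve-∀
      uDP : Unique (D ++ P)
      uDP = Unique-++⁻ʳ U (Unique-↭ (↭-trans (↭-sym perm)
              (↭-trans (↭-reflexive (sym (++-assoc D P U))) (Perm.++-comm (D ++ P) U))) uW)
      DP≤2K : length (D ++ P) ≤ 2 * K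
      DP≤2K = begin
        length (D ++ P)      ≡⟨ length-++ D ⟩
        length D + length P  ≤⟨ +-mono-≤ (≤-reflexive D≡K) (≤-trans P≤ℓ ℓ≤K) ⟩
        K + K                ≡⟨ cong (K +_) (+-identityʳ K) ⟨
        2 * K                ∎

-- Even cycles from doubled paths

lastOf : A → List A → A
lastOf x []       = x
lastOf x (y ∷ ys) = lastOf y ys

lookup-last : ∀ (x : A) xs → lookup (x ∷ xs) (fromℕ (length xs)) ≡ lastOf x xs
lookup-last x []       = refl
lookup-last x (y ∷ ys) = lookup-last y ys

lookup-injective : ∀ {xs : List A} → Unique xs → ∀ {i j} → lookup xs i ≡ lookup xs j → i ≡ j
lookup-injective {xs = x ∷ xs} (x∉ ∷ u) {fzero}  {fzero}  eq = refl
lookup-injective {xs = x ∷ xs} (x∉ ∷ u) {fzero}  {fsuc j} eq = contradiction eq (All.lookup x∉ (∈-lookup j))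
lookup-injective {xs = x ∷ xs} (x∉ ∷ u) {fsuc i} {fzero}  eq = contradiction (sym eq) (All.lookup x∉ (∈-lookup i))
lookup-injective {xs = x ∷ xs} (x∉ ∷ u) {fsuc i} {fsuc j} eq = cong fsuc (lookup-injective u eq)

lookup-linked : ∀ {R : A → A → Set} {x xs} → Linked R (x ∷ xs) →
                ∀ (i : Fin (length xs)) → R (lookup (x ∷ xs) (inject₁ i)) (lookup (x ∷ xs) (fsuc i))
lookup-linked (r ∷ l) fzero    = r
lookup-linked (r ∷ l) (fsuc i) = lookup-linked l i

closed-list⇒cycle : ∀ {m} (G : Graph m) x xs → Unique (x ∷ xs) → Linked (λ y z → adj G y z ≡ true) (x ∷ xs) →
                    adj G (lastOf x xs) x ≡ true → ContainsCycle G (suc (length xs))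
closed-list⇒cycle G x xs u l closes =
  lookup (x ∷ xs) , lookup-injective u , lookup-linked l ,
  trans (cong (λ y → adj G y x) (lookup-last x xs)) closes

-- A path v₀ v₁ … v_k whose vertices are doubled contains the cycle of length 2k that runs
-- forward through all upper copies and back through the lower copies of v_{k-1}, …, v₁.
module Ladder {V X : Set} (top bot : V → X)
              (top-inj : ∀ {v w} → top v ≡ top w → v ≡ w) (bot-inj : ∀ {v w} → bot v ≡ bot w → v ≡ w)
              (top≢bot : ∀ {v w} → top v ≢ bot w) where

  loop : V → List V → List X → List X
  loop v []       acc = acc
  loop v (w ∷ vs) acc = top w ∷ loop w vs (bot v ∷ acc)

  length-loop : ∀ v vs acc → length (loop v vs acc) ≡ 2 * length vs + length acc
  length-loop v []       acc = refl
  length-loop v (w ∷ vs) acc = trans (cong suc (length-loop w vs (bot v ∷ acc))) (count (length vs) (length acc))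
    where
    count : ∀ a b → suc (2 * a + suc b) ≡ 2 * suc a + b
    count = solve-∀

  last-loop : ∀ x v vs a acc → lastOf x (loop v vs (a ∷ acc)) ≡ lastOf a acc
  last-loop x v []       a acc = refl
  last-loop x v (w ∷ vs) a acc = last-loop (top w) w vs (bot v) (a ∷ acc)

  All-loop : ∀ {P : X → Set} v vs {acc} → P (bot v) → All (P ∘ top) vs → All (P ∘ bot) vs → All P acc →
             All P (loop v vs acc)
  All-loop v []       p []       []       ps = ps
  All-loop v (w ∷ vs) p (t ∷ ts) (b ∷ bs) ps = t ∷ All-loop w vs b ts bs (p ∷ ps)

  -- Both copies are tracked, because a vertex sends its upper copy in front of the accumulator and,
  -- unless it is the last, its lower copy into it.
  Fresh : List X → V → Set
  Fresh acc w = All (top w ≢_) acc × All (bot w ≢_) acc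

  Unique-loop : ∀ v vs {acc} → Unique (v ∷ vs) → Unique acc → All (Fresh acc) (v ∷ vs) →
                Unique (loop v vs acc)
  Unique-loop v []       u uacc fresh = uacc
  Unique-loop v (w ∷ vs) (v∉ ∷ uw@(w∉ ∷ _)) uacc ((_ , bv) ∷ fresh@((tw , _) ∷ _)) =
    All-loop w vs top≢bot (All.map (_∘ top-inj) w∉) (All.map (λ _ → top≢bot) w∉) (top≢bot ∷ tw)
    ∷ Unique-loop w vs uw (bv ∷ uacc)
        (All.zipWith (λ (v≢x , t , b) → (top≢bot ∷ t) , ((λ eq → v≢x (sym (bot-inj eq))) ∷ b)) (v∉ , fresh))

  module _ {_~_ : V → V → Set} {R : X → X → Set}
           (tt : ∀ {v w} → v ~ w → R (top v) (top w)) (tb : ∀ {v w} → v ~ w → R (top w) (bot v))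
           (bb : ∀ {v w} → v ~ w → R (bot w) (bot v)) where

    -- What precedes `acc` is `top v` if the path turns around at `v`, and `bot v` if it goes on.
    -- The induction therefore carries both adjacencies.
    Linked-loop : ∀ v vs {acc} → Linked _~_ (v ∷ vs) → Linked R (top v ∷ acc) → Linked R (bot v ∷ acc) →
                  Linked R (top v ∷ loop v vs acc)
    Linked-loop v []       l       lt lb = lt
    Linked-loop v (w ∷ vs) (r ∷ l) lt lb = tt r ∷ Linked-loop w vs l (tb r ∷ lb) (bb r ∷ lb)

doubled-path⇒cycle : ∀ {m} (G : Graph m) {V : Set} (adj′ : V → V → Bool) (adj′-sym : ∀ x y → adj′ x y ≡ adj′ y x)
  (top bot : V → Fin m) → (∀ {v w} → top v ≡ top w → v ≡ w) → (∀ {v w} → bot v ≡ bot w → v ≡ w) →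
  (∀ {v w} → top v ≢ bot w) →
  (∀ v w → adj′ v w ≡ true → adj G (top v) (top w) ≡ true) →
  (∀ v w → adj′ v w ≡ true → adj G (bot v) (top w) ≡ true) →
  (∀ v w → adj′ v w ≡ true → adj G (bot v) (bot w) ≡ true) →
  ∀ k → 2 ≤ k → DepthFirst.Path adj′ adj′-sym (suc k) → ContainsCycle G (2 * k)
doubled-path⇒cycle G adj′ adj′-sym top bot top-inj bot-inj top≢bot tt bt bb k 2≤k
  (v₀ ∷ v₁ ∷ w ∷ vs , len , uv@(v₀∉ ∷ uv₁@(v₁∉ ∷ uw@(w∉ ∷ _))) , r₀ ∷ r₁ ∷ l) =
  -- The loop starts at `v₁`, so that the lower copies of both ends of the path are left out:
  -- `k + 1` upper and `k - 1` lower vertices. The first entry pushed, `bot v₁`, comes last and is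
  -- joined to `top v₀`.
  subst (ContainsCycle G) size (closed-list⇒cycle G (top v₀) (top v₁ ∷ loop v₁ (w ∷ vs) []) unique linked closes)
  where
  open Ladder top bot top-inj bot-inj top≢bot
  unique : Unique (top v₀ ∷ top v₁ ∷ loop v₁ (w ∷ vs) [])
  unique = (All.head avoid ∷ All-loop v₁ (w ∷ vs) top≢bot (All.tail avoid) (All.map (λ _ → top≢bot) v₁∉) [])
         ∷ All-loop v₁ (w ∷ vs) top≢bot (All.map (_∘ top-inj) v₁∉) (All.map (λ _ → top≢bot) v₁∉) []
         ∷ Unique-loop v₁ (w ∷ vs) uv₁ [] (All.universal (λ _ → [] , []) _)
    where
    avoid = All.map (_∘ top-inj) v₀∉
  flip : ∀ {v w} → adj′ v w ≡ true → adj′ w v ≡ true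
  flip {v} {w} p = trans (adj′-sym w v) p
  linked : Linked (λ y z → adj G y z ≡ true) (top v₀ ∷ top v₁ ∷ loop v₁ (w ∷ vs) [])
  linked = tt v₀ v₁ r₀ ∷ Linked-loop (λ {v} {w} → tt v w)
    (λ {v} {w} p → trans (Graph.sym G _ _) (bt v w p))
    (λ {v} {w} p → bb w v (flip p)) v₁ (w ∷ vs) (r₁ ∷ l) [-] [-]
  closes : adj G (lastOf (top v₀) (top v₁ ∷ loop v₁ (w ∷ vs) [])) (top v₀) ≡ true
  closes = trans (cong (λ z → adj G z (top v₀)) (last-loop (top w) w vs (bot v₁) []))
                 (bt v₁ v₀ (flip r₀))
  size : suc (suc (length (loop v₁ (w ∷ vs) []))) ≡ 2 * k
  size = trans (cong (suc ∘ suc) (length-loop v₁ (w ∷ vs) []))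
               (trans (count (length vs)) (cong (2 *_) (suc-injective len)))
    where
    count : ∀ a → suc (suc (2 * suc a + 0)) ≡ 2 * suc (suc a)
    count = solve-∀
doubled-path⇒cycle G adj′ adj′-sym top bot _ _ _ _ _ _ .0 () (v₀ ∷ [] , refl , _)
doubled-path⇒cycle G adj′ adj′-sym top bot _ _ _ _ _ _ .1 (s≤s ()) (v₀ ∷ v₁ ∷ [] , refl , _)

-- Sparse random maps, derandomised

∏ : ∀ {n} → (Fin n → ℕ) → ℕ
∏ {zero}  f = 1
∏ {suc n} f = f fzero * ∏ (f ∘ fsuc)

-- Method of conditional expectations: think of F t as the sum of h t over N choices of y.
Averages : {T Y : Set} → (T → Y → ℕ) → ℕ → (T → ℕ) → Set
Averages {T} h N F = ∀ (ts : List T) (w : T → ℕ) →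
  ∃[ y ] N * ∑ ts (λ t → w t * h t y) ≤ ∑ ts (λ t → w t * F t)

averages-Fin : ∀ {T : Set} {q} .{{_ : NonZero q}} (h : T → Fin q → ℕ) → Averages h q (λ t → ∑ (allFin q) (h t))
averages-Fin {q = suc q} h ts w with ∑-min (λ y → ∑ ts (λ t → w t * h t y))
... | y , le = y , ≤-trans le (≤-reflexive (trans (∑-swap (allFin (suc q)) ts _)
                     (∑-cong ts λ t → ∑-*ˡ (allFin (suc q)) (w t) (h t))))

_∷ᶠ_ : ∀ {n} → A → (Fin n → A) → Fin (suc n) → A
(y ∷ᶠ f) fzero    = y
(y ∷ᶠ f) (fsuc i) = f i

-- The coordinates are fixed one after another: the first against a weight in which the other
-- factors stand at their sums `F`, the rest with the chosen factor absorbed into the weight. This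
-- is why `Averages` allows arbitrary weights. As `Y` is arbitrary, the lemma can be applied to its
-- own conclusion, which handles a double product.
averages-∏ : ∀ {T Y : Set} {L N} (h : Fin L → T → Y → ℕ) (F : Fin L → T → ℕ) →
  (∀ s → Averages (h s) N (F s)) →
  Averages (λ t (f : Fin L → Y) → ∏ (λ s → h s t (f s))) (N ^ L) (λ t → ∏ (λ s → F s t))
averages-∏ {L = zero}  h F avg ts w = (λ ()) , ≤-reflexive (*-identityˡ _)
averages-∏ {L = suc L} {N} h F avg ts w
  with avg fzero ts (λ t → w t * ∏ (λ s → F (fsuc s) t))
... | y , le₀ with averages-∏ (h ∘ fsuc) (F ∘ fsuc) (avg ∘ fsuc) ts (λ t → w t * h fzero t y)
... | f , le = (y ∷ᶠ f) , (begin
  N * N ^ L * ∑ ts (λ t → w t * (h fzero t y * ∏ (λ s → h (fsuc s) t (f s))))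
    ≡⟨ *-assoc N (N ^ L) _ ⟩
  N * (N ^ L * ∑ ts (λ t → w t * (h fzero t y * ∏ (λ s → h (fsuc s) t (f s)))))
    ≡⟨ cong (λ z → N * (N ^ L * z)) (∑-cong ts λ t → sym (*-assoc (w t) (h fzero t y) _)) ⟩
  N * (N ^ L * ∑ ts (λ t → w t * h fzero t y * ∏ (λ s → h (fsuc s) t (f s))))
    ≤⟨ *-monoʳ-≤ N le ⟩
  N * ∑ ts (λ t → w t * h fzero t y * ∏ (λ s → F (fsuc s) t))
    ≡⟨ cong (N *_) (∑-cong ts λ t → rotate (w t) (h fzero t y) (∏ (λ s → F (fsuc s) t))) ⟩
  N * ∑ ts (λ t → w t * ∏ (λ s → F (fsuc s) t) * h fzero t y)
    ≤⟨ le₀ ⟩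
  ∑ ts (λ t → w t * ∏ (λ s → F (fsuc s) t) * F fzero t)
    ≡⟨ ∑-cong ts (λ t → rotate′ (w t) (∏ (λ s → F (fsuc s) t)) (F fzero t)) ⟩
  ∑ ts (λ t → w t * (F fzero t * ∏ (λ s → F (fsuc s) t))) ∎)
  where
  open ≤-Reasoning
  rotate : ∀ a b c → a * b * c ≡ a * c * b
  rotate = solve-∀
  rotate′ : ∀ a b c → a * b * c ≡ a * (c * b)
  rotate′ = solve-∀

-- The hypothesis says, cleared of denominators, that `F s` is at most `N (p/q)^(y s)`. The
-- conclusion has the same shape with `N ^ L` for `N`, so the bound nests.
∏-power-bound : ∀ {L} q p N (F y : Fin L → ℕ) → (∀ s → F s * q ^ y s ≤ N * p ^ y s) →
  ∏ F * q ^ ∑ (allFin L) y ≤ N ^ L * p ^ ∑ (allFin L) y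
∏-power-bound {zero}  q p N F y le = ≤-refl
∏-power-bound {suc L} q p N F y le rewrite ∑-suc y = begin
  F fzero * ∏ (F ∘ fsuc) * q ^ (y fzero + Y)       ≡⟨ cong (F fzero * ∏ (F ∘ fsuc) *_) (^-distribˡ-+-* q (y fzero) Y) ⟩
  F fzero * ∏ (F ∘ fsuc) * (q ^ y fzero * q ^ Y)   ≡⟨ [m*n]*[o*p]≡[m*o]*[n*p] (F fzero) _ _ _ ⟩
  F fzero * q ^ y fzero * (∏ (F ∘ fsuc) * q ^ Y)   ≤⟨ *-mono-≤ (le fzero) (∏-power-bound q p N (F ∘ fsuc) (y ∘ fsuc) (le ∘ fsuc)) ⟩
  N * p ^ y fzero * (N ^ L * p ^ Y)                ≡⟨ [m*n]*[o*p]≡[m*o]*[n*p] N _ _ _ ⟩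
  N * N ^ L * (p ^ y fzero * p ^ Y)                ≡⟨ cong (N * N ^ L *_) (^-distribˡ-+-* p (y fzero) Y) ⟨
  N * N ^ L * p ^ (y fzero + Y)                    ∎
  where
  open ≤-Reasoning
  Y = ∑ (allFin L) (y ∘ fsuc)

-- Bernoulli's inequality `1 + y/q ≤ (1 + 1/q)^y` without denominators. It makes a product of factor
-- sums into one power whose exponent is the total load.
bernoulli : ∀ q y → (q + y) * q ^ y ≤ q * (1 + q) ^ y
bernoulli q zero    = ≤-reflexive (cong (_* 1) (+-identityʳ q))
bernoulli q (suc y) = begin
  (q + suc y) * (q * q ^ y)         ≡⟨ *-assoc (q + suc y) q (q ^ y) ⟨
  (q + suc y) * q * q ^ y           ≤⟨ *-monoˡ-≤ (q ^ y) (m≤m+n ((q + suc y) * q) y) ⟩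
  ((q + suc y) * q + y) * q ^ y     ≡⟨ regroup q y (q ^ y) ⟩
  (1 + q) * ((q + y) * q ^ y)       ≤⟨ *-monoʳ-≤ (1 + q) (bernoulli q y) ⟩
  (1 + q) * (q * (1 + q) ^ y)       ≡⟨ exchange (1 + q) q ((1 + q) ^ y) ⟩
  q * ((1 + q) * (1 + q) ^ y)       ∎
  where
  open ≤-Reasoning
  regroup : ∀ q y z → ((q + suc y) * q + y) * z ≡ (1 + q) * ((q + y) * z)
  regroup = solve-∀
  exchange : ∀ a b c → a * (b * c) ≡ b * (a * c)
  exchange = solve-∀

-- Bernoulli's inequality for `(1 - 1/(1 + q))^j`, without denominators; `s` stands for `1 + q - j`,
-- avoiding subtraction.
bernoulli⁻ : ∀ q j s → s + j ≡ 1 + q → (1 + q) ^ j * s ≤ q ^ j * (1 + q)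
bernoulli⁻ q zero    s eq = ≤-reflexive (cong (1 *_) (trans (sym (+-identityʳ s)) eq))
bernoulli⁻ q (suc j) s eq = begin
  (1 + q) * (1 + q) ^ j * s        ≡⟨ regroup (1 + q) ((1 + q) ^ j) s ⟩
  (1 + q) ^ j * (s + q * s)        ≤⟨ *-monoʳ-≤ ((1 + q) ^ j) (+-monoˡ-≤ (q * s) s≤q) ⟩
  (1 + q) ^ j * (q + q * s)        ≡⟨ regroup′ ((1 + q) ^ j) q s ⟩
  q * ((1 + q) ^ j * suc s)        ≤⟨ *-monoʳ-≤ q (bernoulli⁻ q j (suc s) (trans (sym (+-suc s j)) eq)) ⟩
  q * (q ^ j * (1 + q))            ≡⟨ *-assoc q (q ^ j) (1 + q) ⟨
  q * q ^ j * (1 + q)              ∎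
  where
  open ≤-Reasoning
  s≤q : s ≤ q
  s≤q = ≤-trans (m≤m+n s j) (≤-reflexive (suc-injective (trans (sym (+-suc s j)) eq)))
  regroup : ∀ a b c → a * b * c ≡ b * (a * c)
  regroup = solve-∀
  regroup′ : ∀ a q s → a * (q + q * s) ≡ q * (a * suc s)
  regroup′ = solve-∀

-- By `bernoulli⁻`, `(1 + 1/(2h))^h` is at most `(1 + 2h)/(1 + h)`, which is below 2.
[1+2h]^h≤2[2h]^h : ∀ h → (1 + 2 * h) ^ h ≤ 2 * (2 * h) ^ h
[1+2h]^h≤2[2h]^h h = *-cancelʳ-≤ _ _ (1 + 2 * h) (begin
  (1 + 2 * h) ^ h * (1 + 2 * h)       ≤⟨ *-monoʳ-≤ ((1 + 2 * h) ^ h) (n≤1+n _) ⟩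
  (1 + 2 * h) ^ h * (2 + 2 * h)       ≡⟨ double ((1 + 2 * h) ^ h) h ⟩
  2 * ((1 + 2 * h) ^ h * (1 + h))     ≤⟨ *-monoʳ-≤ 2 (bernoulli⁻ (2 * h) h (1 + h) (half h)) ⟩
  2 * ((2 * h) ^ h * (1 + 2 * h))     ≡⟨ *-assoc 2 ((2 * h) ^ h) (1 + 2 * h) ⟨
  2 * (2 * h) ^ h * (1 + 2 * h)       ∎)
  where
  open ≤-Reasoning
  double : ∀ a h → a * (2 + 2 * h) ≡ 2 * (a * (1 + h))
  double = solve-∀
  half : ∀ h → 1 + h + h ≡ 1 + 2 * h
  half = solve-∀

^-distrib-* : ∀ a b n → (a * b) ^ n ≡ a ^ n * b ^ n
^-distrib-* a b zero    = refl
^-distrib-* a b (suc n) = trans (cong (a * b *_) (^-distrib-* a b n)) ([m*n]*[o*p]≡[m*o]*[n*p] a b _ _)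

[1+2h]^Y≤2^Q[2h]^Y : ∀ h .{{_ : NonZero h}} Q Y → Y ≤ h * Q → (1 + 2 * h) ^ Y ≤ 2 ^ Q * (2 * h) ^ Y
-- Padding the exponent by `Z` to the multiple `h * Q` lets the previous bound be used `Q` times.
[1+2h]^Y≤2^Q[2h]^Y h Q Y Y≤hQ = *-cancelʳ-≤ _ _ (q ^ Z) {{m^n≢0 q Z {{m*n≢0 2 h}}}} (begin
  (1 + q) ^ Y * q ^ Z         ≤⟨ *-monoʳ-≤ ((1 + q) ^ Y) (^-monoˡ-≤ Z (n≤1+n q)) ⟩
  (1 + q) ^ Y * (1 + q) ^ Z   ≡⟨ ^-distribˡ-+-* (1 + q) Y Z ⟨
  (1 + q) ^ (Y + Z)           ≡⟨ cong ((1 + q) ^_) Y+Z≡hQ ⟩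
  (1 + q) ^ (h * Q)           ≡⟨ ^-*-assoc (1 + q) h Q ⟨
  ((1 + q) ^ h) ^ Q           ≤⟨ ^-monoˡ-≤ Q ([1+2h]^h≤2[2h]^h h) ⟩
  (2 * q ^ h) ^ Q             ≡⟨ ^-distrib-* 2 (q ^ h) Q ⟩
  2 ^ Q * (q ^ h) ^ Q         ≡⟨ cong (2 ^ Q *_) (^-*-assoc q h Q) ⟩
  2 ^ Q * q ^ (h * Q)         ≡⟨ cong (λ z → 2 ^ Q * q ^ z) Y+Z≡hQ ⟨
  2 ^ Q * q ^ (Y + Z)         ≡⟨ cong (2 ^ Q *_) (^-distribˡ-+-* q Y Z) ⟩
  2 ^ Q * (q ^ Y * q ^ Z)     ≡⟨ *-assoc (2 ^ Q) (q ^ Y) (q ^ Z) ⟨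
  2 ^ Q * q ^ Y * q ^ Z       ∎)
  where
  open ≤-Reasoning
  q = 2 * h
  Z = h * Q ∸ Y
  Y+Z≡hQ : Y + Z ≡ h * Q
  Y+Z≡hQ = m+[n∸m]≡n Y≤hQ

2^-cancel-≤ : ∀ a b → 2 ^ a ≤ 2 ^ b → a ≤ b
2^-cancel-≤ a b le with a ≤? b
... | yes a≤b = a≤b
... | no a≰b  = contradiction le (<⇒≱ (^-monoʳ-< 2 (s≤s (s≤s z≤n)) (≰⇒> a≰b)))

2^∑≤∏ : ∀ {L} (h : Fin L → ℕ) (x : Fin L → ℕ) → (∀ s → 2 ^ x s ≤ h s) → 2 ^ ∑ (allFin L) x ≤ ∏ h
2^∑≤∏ {zero}  h x le = ≤-refl
2^∑≤∏ {suc L} h x le rewrite ∑-suc x = ≤-trans (≤-reflexive (^-distribˡ-+-* 2 (x fzero) _))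
  (*-mono-≤ (le fzero) (2^∑≤∏ (h ∘ fsuc) (x ∘ fsuc) (le ∘ fsuc)))

length-cartesianProduct : ∀ (xs : List A) (ys : List B) → length (cartesianProduct xs ys) ≡ length xs * length ys
length-cartesianProduct []       ys = refl
length-cartesianProduct (x ∷ xs) ys = trans (length-++ (map (x ,_) ys))
  (cong₂ _+_ (length-map (x ,_) ys) (length-cartesianProduct xs ys))

-- Subsets are coded by vectors since membership in an enumeration of functions would call for
-- function extensionality.
bitVectors : ∀ n → List (Vec Bool n)
bitVectors zero    = [] ∷ []
bitVectors (suc n) = map (true ∷_) (bitVectors n) ++ map (false ∷_) (bitVectors n)

length-bitVectors : ∀ n → length (bitVectors n) ≡ 2 ^ n
length-bitVectors zero    = refl
length-bitVectors (suc n) = trans (length-++ (map (true ∷_) (bitVectors n)))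
  (cong₂ _+_ (trans (length-map (true ∷_) (bitVectors n)) (length-bitVectors n))
    (trans (trans (length-map (false ∷_) (bitVectors n)) (length-bitVectors n)) (sym (+-identityʳ _))))

∈-bitVectors : ∀ {n} (v : Vec Bool n) → v ∈ bitVectors n
∈-bitVectors []          = here refl
∈-bitVectors (true  ∷ v) = ∈-++⁺ˡ (∈-map⁺ (true ∷_) (∈-bitVectors v))
∈-bitVectors {suc n} (false ∷ v) = ∈-++⁺ʳ (map (true ∷_) (bitVectors n)) (∈-map⁺ (false ∷_) (∈-bitVectors v))

module RandomMap (d m h Q s : ℕ) .{{_ : NonZero h}} (s²≤hQ : s * s ≤ h * Q) where
  private
    q = 2 * h
    instance
      q≢0 : NonZero q
      q≢0 = m*n≢0 2 h

  Test : Set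
  Test = Vec Bool m × Vec Bool (d * q)

  tests : List Test
  tests = cartesianProduct (bitVectors m) (bitVectors (d * q))

  length-tests : length tests ≡ 2 ^ (m + d * q)
  length-tests = trans (length-cartesianProduct (bitVectors m) (bitVectors (d * q)))
    (trans (cong₂ _*_ (length-bitVectors m) (length-bitVectors (d * q))) (sym (^-distribˡ-+-* 2 m (d * q))))

  α : Test → Fin m → ℕ
  α t a = 𝟙 (Vec.lookup (proj₁ t) a)

  β : Test → Fin d → Fin q → ℕ
  β t i y = 𝟙 (Vec.lookup (proj₂ t) (combine i y))

  ∣α∣ ∣β∣ : Test → ℕ
  ∣α∣ t = ∑ (allFin m) (α t)
  ∣β∣ t = ∑ (allFin d) (λ i → ∑ (allFin q) (β t i))

  Small : Test → Set
  Small t = ∣α∣ t ≤ s × ∣β∣ t ≤ s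

  -- Tests with a large set are switched off: their total load is not bounded by `h * Q`, and they
  -- would spoil the average.
  weight : Test → ℕ
  weight t = 𝟙 (⌊ ∣α∣ t ≤? s ⌋ ∧ ⌊ ∣β∣ t ≤? s ⌋)

  weight-small : ∀ t → Small t → weight t ≡ 1
  weight-small t (p , r) with ∣α∣ t ≤? s | ∣β∣ t ≤? s
  ... | yes _ | yes _ = refl
  ... | no ¬p | _     = contradiction p ¬p
  ... | yes _ | no ¬r = contradiction r ¬r

  -- Equal to 2 if the edge chosen for `i` and `a` joins the two sets of the test and to 1
  -- otherwise. The product over all `i` and `a` is 2 to the number of such edges, the exponential
  -- moment of a Chernoff bound.
  factor : Fin d → Fin m → Test → Fin q → ℕ
  factor i a t y = 1 + α t a * β t i y

  factorSum : Fin d → Fin m → Test → ℕ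
  factorSum i a t = ∑ (allFin q) (factor i a t)

  load : Test → Fin d → Fin m → ℕ
  load t i a = α t a * ∑ (allFin q) (β t i)

  factorSum≡ : ∀ i a t → factorSum i a t ≡ q + load t i a
  factorSum≡ i a t = trans (∑-+ (allFin q) (λ _ → 1) _)
    (cong₂ _+_ (trans (∑-constFin q 1) (*-identityʳ q)) (∑-*ˡ (allFin q) (α t a) (β t i)))

  -- Relative to the number of choices the product is at most `(1 + 1/q)^Y`. The total load `Y`
  -- factors as `∣α∣ t * ∣β∣ t`, at most `h * Q`, and every `h` units of exponent cost a factor of
  -- at most 2.
  ∏factorSum≤ : ∀ t → Small t → ∏ (λ i → ∏ (λ a → factorSum i a t)) ≤ (q ^ m) ^ d * 2 ^ Q
  ∏factorSum≤ t (α≤s , β≤s) = *-cancelʳ-≤ _ _ (q ^ Y) {{m^n≢0 q Y}} (begin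
    ∏ (λ i → ∏ (λ a → factorSum i a t)) * q ^ Y
      ≤⟨ ∏-power-bound q (1 + q) (q ^ m) _ _ (λ i → ∏-power-bound q (1 + q) q _ (load t i) (single i)) ⟩
    (q ^ m) ^ d * (1 + q) ^ Y
      ≤⟨ *-monoʳ-≤ ((q ^ m) ^ d) ([1+2h]^Y≤2^Q[2h]^Y h Q Y Y≤hQ) ⟩
    (q ^ m) ^ d * (2 ^ Q * q ^ Y)
      ≡⟨ *-assoc ((q ^ m) ^ d) (2 ^ Q) (q ^ Y) ⟨
    (q ^ m) ^ d * 2 ^ Q * q ^ Y ∎)
    where
    open ≤-Reasoning
    Y = ∑ (allFin d) (λ i → ∑ (allFin m) (load t i))
    single : ∀ i a → factorSum i a t * q ^ load t i a ≤ q * (1 + q) ^ load t i a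
    single i a = ≤-trans (≤-reflexive (cong (_* q ^ load t i a) (factorSum≡ i a t))) (bernoulli q (load t i a))
    Y≤hQ : Y ≤ h * Q
    Y≤hQ = begin
      Y                ≡⟨ ∑-swap (allFin d) (allFin m) (load t) ⟩
      ∑ (allFin m) (λ a → ∑ (allFin d) (λ i → load t i a))
                       ≡⟨ ∑-product (allFin m) (allFin d) (α t) (λ i → ∑ (allFin q) (β t i)) ⟩
      ∣α∣ t * ∣β∣ t    ≤⟨ *-mono-≤ α≤s β≤s ⟩
      s * s            ≤⟨ s²≤hQ ⟩
      h * Q            ∎

  weighted≤ : ∀ t → weight t * ∏ (λ i → ∏ (λ a → factorSum i a t)) ≤ (q ^ m) ^ d * 2 ^ Q
  weighted≤ t with ∣α∣ t ≤? s | ∣β∣ t ≤? s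
  ... | yes p | yes r = ≤-trans (≤-reflexive (*-identityˡ _)) (∏factorSum≤ t (p , r))
  ... | no _  | _     = z≤n
  ... | yes _ | no _  = z≤n

  chosen = averages-∏ {N = q ^ m} (λ i t (g : Fin m → Fin q) → ∏ (λ a → factor i a t (g a))) (λ i t → ∏ (λ a → factorSum i a t))
    (λ i → averages-∏ (factor i) (factorSum i) (λ a → averages-Fin (factor i a))) tests weight

  choice : Fin d → Fin m → Fin q
  choice = proj₁ chosen

  hits : Test → ℕ
  hits t = ∑ (allFin d) (λ i → ∑ (allFin m) (λ a → α t a * β t i (choice i a)))

  -- The union bound: a single term of the sum over tests is at most the whole sum, which has
  -- `2 ^ (m + d * q)` terms, each bounded by `N * 2 ^ Q`.
  hits≤ : ∀ t → Small t → hits t ≤ m + d * q + Q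
  hits≤ t small = 2^-cancel-≤ _ _ (*-cancelˡ-≤ N {{m^n≢0 (q ^ m) d {{m^n≢0 q m}}}} (begin
    N * 2 ^ hits t
      ≤⟨ *-monoʳ-≤ N (2^∑≤∏ _ _ λ i → 2^∑≤∏ _ _ λ a → 2^αβ≤ (Vec.lookup (proj₁ t) a) (Vec.lookup (proj₂ t) (combine i (choice i a)))) ⟩
    N * H t
      ≡⟨ cong (N *_) (trans (cong (_* H t) (weight-small t small)) (*-identityˡ (H t))) ⟨
    N * (weight t * H t)
      ≤⟨ *-monoʳ-≤ N (∑-∈ (λ t → weight t * H t) (∈-cartesianProduct⁺ (∈-bitVectors (proj₁ t)) (∈-bitVectors (proj₂ t)))) ⟩
    N * ∑ tests (λ t → weight t * H t)
      ≤⟨ proj₂ chosen ⟩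
    ∑ tests (λ t → weight t * ∏ (λ i → ∏ (λ a → factorSum i a t)))
      ≤⟨ ∑-mono tests weighted≤ ⟩
    ∑ tests (λ _ → N * 2 ^ Q)
      ≡⟨ ∑-const tests (N * 2 ^ Q) ⟩
    length tests * (N * 2 ^ Q)
      ≡⟨ cong (_* (N * 2 ^ Q)) length-tests ⟩
    2 ^ (m + d * q) * (N * 2 ^ Q)
      ≡⟨ exchange (2 ^ (m + d * q)) N (2 ^ Q) ⟩
    N * (2 ^ (m + d * q) * 2 ^ Q)
      ≡⟨ cong (N *_) (^-distribˡ-+-* 2 (m + d * q) Q) ⟨
    N * 2 ^ (m + d * q + Q) ∎))
    where
    open ≤-Reasoning
    N = (q ^ m) ^ d
    H : Test → ℕ
    H t = ∏ (λ i → ∏ (λ a → factor i a t (choice i a)))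
    exchange : ∀ a b c → a * (b * c) ≡ b * (a * c)
    exchange = solve-∀
    2^αβ≤ : ∀ a b → 2 ^ (𝟙 a * 𝟙 b) ≤ 1 + 𝟙 a * 𝟙 b
    2^αβ≤ true  true  = ≤-refl
    2^αβ≤ true  false = ≤-refl
    2^αβ≤ false b     = ≤-refl

sparse-map : ∀ d m h Q s .{{_ : NonZero h}} → s * s ≤ h * Q →
  Σ (Fin d → Fin m → Fin (2 * h)) λ f →
  ∀ (α : Fin m → Bool) (β : Fin (d * (2 * h)) → Bool) →
  ∑ (allFin m) (𝟙 ∘ α) ≤ s → ∑ (allFin (d * (2 * h))) (𝟙 ∘ β) ≤ s →
  ∑ (allFin d) (λ i → ∑ (allFin m) (λ a → 𝟙 (α a) * 𝟙 (β (combine i (f i a))))) ≤ m + d * (2 * h) + Q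
sparse-map d m h Q s s²≤hQ = choice , λ α′ β′ α≤s β≤s →
  let α≡ = λ a → cong 𝟙 (lookup∘tabulate α′ a)
      β≡ = λ v → cong 𝟙 (lookup∘tabulate β′ v)
  in ≤-trans
    (≤-reflexive (∑-cong (allFin d) λ i → ∑-cong (allFin m) λ a →
      sym (cong₂ _*_ (α≡ a) (β≡ (combine i (choice i a))))))
    (hits≤ (tabulate α′ , tabulate β′)
      ( ≤-trans (≤-reflexive (∑-cong (allFin m) α≡)) α≤s
      , ≤-trans (≤-reflexive (trans (sym (∑-combine d (𝟙 ∘ Vec.lookup (tabulate β′)))) (∑-cong (allFin (d * (2 * h))) β≡))) β≤s))
  where open RandomMap d m h Q s s²≤hQ

-- Bipartite graphs

𝟙-mono : ∀ {a b} → (a ≡ true → b ≡ true) → 𝟙 a ≤ 𝟙 b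
𝟙-mono {true}  a⇒b = ≤-reflexive (cong 𝟙 (sym (a⇒b refl)))
𝟙-mono {false} a⇒b = z≤n

module _ {a b : ℕ} where

  biAdj : (Fin a → Fin b → Bool) → Fin a ⊎ Fin b → Fin a ⊎ Fin b → Bool
  biAdj E (inj₁ x) (inj₂ y) = E x y
  biAdj E (inj₂ y) (inj₁ x) = E x y
  biAdj E (inj₁ _) (inj₁ _) = false
  biAdj E (inj₂ _) (inj₂ _) = false

  biAdj-sym : ∀ E p r → biAdj E p r ≡ biAdj E r p
  biAdj-sym E (inj₁ _) (inj₁ _) = refl
  biAdj-sym E (inj₁ _) (inj₂ _) = refl
  biAdj-sym E (inj₂ _) (inj₁ _) = refl
  biAdj-sym E (inj₂ _) (inj₂ _) = refl

  bipartiteGraph : (Fin a → Fin b → Bool) → Graph (a + b)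
  bipartiteGraph E = record
    { adj    = λ i j → biAdj E (splitAt a i) (splitAt a j)
    ; sym    = λ i j → biAdj-sym E (splitAt a i) (splitAt a j)
    ; irrefl = λ i → no-loop (splitAt a i)
    }
    where
    no-loop : ∀ p → biAdj E p p ≡ false
    no-loop (inj₁ _) = refl
    no-loop (inj₂ _) = refl

  bipartiteGraph-bipartite : ∀ E → Bipartite (bipartiteGraph E)
  bipartiteGraph-bipartite E = (λ i → side (splitAt a i)) , λ i j → proper (splitAt a i) (splitAt a j)
    where
    side : Fin a ⊎ Fin b → Bool
    side (inj₁ _) = false
    side (inj₂ _) = true
    proper : ∀ p r → biAdj E p r ≡ true → side p ≢ side r
    proper (inj₁ _) (inj₂ _) _ ()
    proper (inj₂ _) (inj₁ _) _ ()

  -- Left vertices are numbered before right ones, so the order test in `edgeCount` retains each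
  -- edge once, read from left to right.
  edgeCount-bipartite : ∀ E (J : Graph (a + b)) → J ⊆G bipartiteGraph E →
    edgeCount J ≡ ∑ (allFin a) (λ x → ∑ (allFin b) (λ y → 𝟙 (adj J (x ↑ˡ b) (a ↑ʳ y))))
  edgeCount-bipartite E J J⊆ = begin
    edgeCount J
      ≡⟨ ∑-split a (λ i → ∑ (allFin (a + b)) (term i)) ⟩
    ∑ (allFin a) (λ x → ∑ (allFin (a + b)) (term (x ↑ˡ b))) + ∑ (allFin b) (λ y → ∑ (allFin (a + b)) (term (a ↑ʳ y)))
      ≡⟨ cong₂ _+_ (∑-cong (allFin a) left) (trans (∑-cong (allFin b) right) (∑-zero (allFin b))) ⟩
    ∑ (allFin a) (λ x → ∑ (allFin b) (λ y → 𝟙 (adj J (x ↑ˡ b) (a ↑ʳ y)))) + 0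
      ≡⟨ +-identityʳ _ ⟩
    ∑ (allFin a) (λ x → ∑ (allFin b) (λ y → 𝟙 (adj J (x ↑ˡ b) (a ↑ʳ y)))) ∎
    where
    open ≡-Reasoning
    term : Fin (a + b) → Fin (a + b) → ℕ
    term i j = 𝟙 ((toℕ i <ᵇ toℕ j) ∧ adj J i j)
    non-edge : ∀ i j → biAdj E (splitAt a i) (splitAt a j) ≡ false → adj J i j ≡ false
    non-edge i j none with adj J i j in eq
    ... | false = refl
    ... | true with () ← trans (sym none) (J⊆ i j eq)
    ∧-false : ∀ c {d} → d ≡ false → 𝟙 (c ∧ d) ≡ 0
    ∧-false true  refl = refl
    ∧-false false refl = refl
    <ᵇ-true : ∀ {i j} → i < j → (i <ᵇ j) ≡ true
    <ᵇ-true {i} {j} i<j with i <ᵇ j | <⇒<ᵇ i<j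
    ... | true | _ = refl
    <ᵇ-false : ∀ {i j} → j ≤ i → (i <ᵇ j) ≡ false
    <ᵇ-false {i} {j} j≤i with i <ᵇ j in eq
    ... | false = refl
    ... | true  = contradiction (<ᵇ⇒< i j (subst T (sym eq) _)) (≤⇒≯ j≤i)
    x<y : ∀ (x : Fin a) (y : Fin b) → toℕ (x ↑ˡ b) < toℕ (a ↑ʳ y)
    x<y x y = ≤-trans (≤-reflexive (cong suc (Fin.toℕ-↑ˡ x b)))
      (≤-trans (Fin.toℕ<n x) (≤-trans (m≤m+n a (toℕ y)) (≤-reflexive (sym (Fin.toℕ-↑ʳ a y)))))
    left : ∀ x → ∑ (allFin (a + b)) (term (x ↑ˡ b)) ≡ ∑ (allFin b) (λ y → 𝟙 (adj J (x ↑ˡ b) (a ↑ʳ y)))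
    left x = trans (∑-split a (term (x ↑ˡ b))) (cong₂ _+_
      (trans (∑-cong (allFin a) λ x′ → ∧-false (toℕ (x ↑ˡ b) <ᵇ toℕ (x′ ↑ˡ b))
        (non-edge _ _ (cong₂ (biAdj E) (Fin.splitAt-↑ˡ a x b) (Fin.splitAt-↑ˡ a x′ b)))) (∑-zero (allFin a)))
      (∑-cong (allFin b) λ y → cong (λ c → 𝟙 (c ∧ adj J (x ↑ˡ b) (a ↑ʳ y))) (<ᵇ-true (x<y x y))))
    right : ∀ y → ∑ (allFin (a + b)) (term (a ↑ʳ y)) ≡ 0
    right y = trans (∑-split a (term (a ↑ʳ y))) (cong₂ _+_
      (trans (∑-cong (allFin a) λ x → cong (λ c → 𝟙 (c ∧ adj J (a ↑ʳ y) (x ↑ˡ b))) (<ᵇ-false (<⇒≤ (x<y x y))))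
        (∑-zero (allFin a)))
      (trans (∑-cong (allFin b) λ y′ → ∧-false (toℕ (a ↑ʳ y) <ᵇ toℕ (a ↑ʳ y′))
        (non-edge _ _ (cong₂ (biAdj E) (Fin.splitAt-↑ʳ a b y) (Fin.splitAt-↑ʳ a b y′)))) (∑-zero (allFin b))))

  vertices : List (Fin a ⊎ Fin b)
  vertices = map inj₁ (allFin a) ++ map inj₂ (allFin b)

  vertices-unique : Unique vertices
  vertices-unique = Unique.++⁺ (Unique.map⁺ inj₁-injective (Unique.allFin⁺ a))
    (Unique.map⁺ inj₂-injective (Unique.allFin⁺ b)) disjoint
    where
    disjoint : Disjoint (map inj₁ (allFin a)) (map inj₂ (allFin b))
    disjoint (p , r) with ∈-map⁻ inj₁ p | ∈-map⁻ inj₂ r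
    ... | _ , _ , refl | _ , _ , ()

  length-vertices : length vertices ≡ a + b
  length-vertices = trans (length-++ (map inj₁ (allFin a)))
    (cong₂ _+_ (trans (length-map inj₁ (allFin a)) (length-allFin a)) (trans (length-map inj₂ (allFin b)) (length-allFin b)))

  ∑-vertices : ∀ f → ∑ vertices f ≡ ∑ (allFin a) (f ∘ inj₁) + ∑ (allFin b) (f ∘ inj₂)
  ∑-vertices f = trans (∑-++ (map inj₁ (allFin a)) _ f) (cong₂ _+_ (∑-map (allFin a) inj₁ f) (∑-map (allFin b) inj₂ f))

  δ⊎ : Fin a ⊎ Fin b → Fin a ⊎ Fin b → ℕ
  δ⊎ (inj₁ x) (inj₁ x′) = δ x x′
  δ⊎ (inj₂ y) (inj₂ y′) = δ y y′
  δ⊎ (inj₁ _) (inj₂ _)  = 0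
  δ⊎ (inj₂ _) (inj₁ _)  = 0

  ∑-δ⊎ : ∀ p (f : Fin a ⊎ Fin b → ℕ) → ∑ vertices (λ r → δ⊎ p r * f r) ≡ f p
  ∑-δ⊎ (inj₁ x) f = trans (∑-vertices _) (trans (cong₂ _+_ (∑-δ x (f ∘ inj₁)) (∑-zero (allFin b))) (+-identityʳ _))
  ∑-δ⊎ (inj₂ y) f = trans (∑-vertices _) (cong₂ _+_ (∑-zero (allFin a)) (∑-δ y (f ∘ inj₂)))

  δ⊎-≢ : ∀ p r → p ≢ r → δ⊎ p r ≡ 0
  δ⊎-≢ (inj₁ x) (inj₁ x′) p≢r = δ≢ (p≢r ∘ cong inj₁)
  δ⊎-≢ (inj₂ y) (inj₂ y′) p≢r = δ≢ (p≢r ∘ cong inj₂)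
  δ⊎-≢ (inj₁ _) (inj₂ _)  _   = refl
  δ⊎-≢ (inj₂ _) (inj₁ _)  _   = refl

  δ⊎≤1 : ∀ p r → δ⊎ p r ≤ 1
  δ⊎≤1 (inj₁ x) (inj₁ x′) = 𝟙≤1 _
  δ⊎≤1 (inj₂ y) (inj₂ y′) = 𝟙≤1 _
  δ⊎≤1 (inj₁ _) (inj₂ _)  = z≤n
  δ⊎≤1 (inj₂ _) (inj₁ _)  = z≤n

  -- The bridge from vertex lists, over which the search counts edges, to the Boolean sets in
  -- `sparse-map`: on a duplicate-free list it is an indicator function.
  multiplicity : List (Fin a ⊎ Fin b) → Fin a ⊎ Fin b → ℕ
  multiplicity Z r = ∑ Z (λ z → δ⊎ z r)

  ∑-multiplicity : ∀ Z f → ∑ Z f ≡ ∑ vertices (λ r → multiplicity Z r * f r)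
  ∑-multiplicity Z f = begin
    ∑ Z f                                            ≡⟨ ∑-cong Z (λ z → ∑-δ⊎ z f) ⟨
    ∑ Z (λ z → ∑ vertices (λ r → δ⊎ z r * f r))      ≡⟨ ∑-swap Z vertices _ ⟩
    ∑ vertices (λ r → ∑ Z (λ z → δ⊎ z r * f r))      ≡⟨ ∑-cong vertices (λ r → ∑-*ʳ Z (f r) (λ z → δ⊎ z r)) ⟩
    ∑ vertices (λ r → multiplicity Z r * f r)        ∎
    where open ≡-Reasoning

  multiplicity≡0 : ∀ {Z r} → All (r ≢_) Z → multiplicity Z r ≡ 0
  multiplicity≡0 []         = refl
  multiplicity≡0 (r≢z ∷ r∉) = cong₂ _+_ (δ⊎-≢ _ _ (r≢z ∘ sym)) (multiplicity≡0 r∉)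

  multiplicity≤1 : ∀ {Z} → Unique Z → ∀ r → multiplicity Z r ≤ 1
  multiplicity≤1 {[]}    _        r = z≤n
  multiplicity≤1 {z ∷ Z} (z∉ ∷ u) r with δ⊎ z r in eq
  ... | zero  = multiplicity≤1 u r
  ... | suc k = ≤-trans (≤-reflexive (trans (cong (suc k +_) (multiplicity≡0 (subst (λ s → All (s ≢_) Z) z≡r z∉))) (+-identityʳ _)))
                        (subst (_≤ 1) eq (δ⊎≤1 z r))
    where
    z≡r : z ≡ r
    z≡r with ≡-dec Fin._≟_ Fin._≟_ z r
    ... | yes p = p
    ... | no ¬p with () ← trans (sym (δ⊎-≢ z r ¬p)) eq

  support : List (Fin a ⊎ Fin b) → Fin a ⊎ Fin b → Bool
  support Z r = 0 <ᵇ multiplicity Z r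

  𝟙-support : ∀ {Z} → Unique Z → ∀ r → 𝟙 (support Z r) ≡ multiplicity Z r
  𝟙-support {Z} u r = 𝟙-positive (multiplicity≤1 u r)
    where
    𝟙-positive : ∀ {n} → n ≤ 1 → 𝟙 (0 <ᵇ n) ≡ n
    𝟙-positive z≤n       = refl
    𝟙-positive (s≤s z≤n) = refl

  support-size : ∀ {Z} → Unique Z →
    ∑ (allFin a) (λ x → 𝟙 (support Z (inj₁ x))) + ∑ (allFin b) (λ y → 𝟙 (support Z (inj₂ y))) ≡ length Z
  support-size {Z} u = begin
    ∑ (allFin a) (λ x → 𝟙 (support Z (inj₁ x))) + ∑ (allFin b) (λ y → 𝟙 (support Z (inj₂ y)))
      ≡⟨ ∑-vertices (λ r → 𝟙 (support Z r)) ⟨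
    ∑ vertices (λ r → 𝟙 (support Z r))
      ≡⟨ ∑-cong vertices (λ r → trans (𝟙-support u r) (sym (*-identityʳ _))) ⟩
    ∑ vertices (λ r → multiplicity Z r * 1)
      ≡⟨ ∑-multiplicity Z (λ _ → 1) ⟨
    ∑ Z (λ _ → 1)
      ≡⟨ trans (∑-const Z 1) (*-identityʳ _) ⟩
    length Z ∎
    where open ≡-Reasoning

  module _ (E : Fin a → Fin b → Bool) where
    open DepthFirst (biAdj E) (biAdj-sym E)

    -- Each edge is seen from both ends. Weights are arbitrary so as to cover both the indicator of
    -- a set and the constant 1.
    edges-weighted : ∀ (μ : Fin a ⊎ Fin b → ℕ) →
      ∑ vertices (λ p → μ p * ∑ vertices (λ r → μ r * 𝟙 (biAdj E p r)))
      ≡ 2 * ∑ (allFin a) (λ x → ∑ (allFin b) (λ y → μ (inj₁ x) * (μ (inj₂ y) * 𝟙 (E x y))))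
    edges-weighted μ = begin
      ∑ vertices (λ p → μ p * ∑ vertices (λ r → μ r * 𝟙 (biAdj E p r)))
        ≡⟨ ∑-vertices _ ⟩
      ∑ (allFin a) (λ x → μ (inj₁ x) * ∑ vertices (λ r → μ r * 𝟙 (biAdj E (inj₁ x) r)))
        + ∑ (allFin b) (λ y → μ (inj₂ y) * ∑ vertices (λ r → μ r * 𝟙 (biAdj E (inj₂ y) r)))
        ≡⟨ cong₂ _+_ (∑-cong (allFin a) left) (trans (∑-cong (allFin b) right) (∑-swap (allFin b) (allFin a) _)) ⟩
      X + X
        ≡⟨ cong (X +_) (+-identityʳ X) ⟨
      2 * X ∎
      where
      open ≡-Reasoning
      X = ∑ (allFin a) (λ x → ∑ (allFin b) (λ y → μ (inj₁ x) * (μ (inj₂ y) * 𝟙 (E x y))))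
      left : ∀ x → μ (inj₁ x) * ∑ vertices (λ r → μ r * 𝟙 (biAdj E (inj₁ x) r))
                 ≡ ∑ (allFin b) (λ y → μ (inj₁ x) * (μ (inj₂ y) * 𝟙 (E x y)))
      left x = trans (cong (μ (inj₁ x) *_) (trans (∑-vertices _)
        (cong (_+ ∑ (allFin b) (λ y → μ (inj₂ y) * 𝟙 (E x y)))
          (trans (∑-cong (allFin a) λ x′ → *-zeroʳ (μ (inj₁ x′))) (∑-zero (allFin a))))))
        (sym (∑-*ˡ (allFin b) (μ (inj₁ x)) _))
      exchange : ∀ u v w → u * (v * w) ≡ v * (u * w)
      exchange = solve-∀
      right : ∀ y → μ (inj₂ y) * ∑ vertices (λ r → μ r * 𝟙 (biAdj E (inj₂ y) r))
                  ≡ ∑ (allFin a) (λ x → μ (inj₁ x) * (μ (inj₂ y) * 𝟙 (E x y)))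
      right y = trans (cong (μ (inj₂ y) *_) (trans (∑-vertices _)
        (trans (cong (∑ (allFin a) (λ x → μ (inj₁ x) * 𝟙 (E x y)) +_)
          (trans (∑-cong (allFin b) λ y′ → *-zeroʳ (μ (inj₂ y′))) (∑-zero (allFin b)))) (+-identityʳ _))))
        (trans (sym (∑-*ˡ (allFin a) (μ (inj₂ y)) _))
               (∑-cong (allFin a) λ x → exchange (μ (inj₂ y)) (μ (inj₁ x)) (𝟙 (E x y))))

    edges-support : ∀ {Z} → Unique Z → edges Z Z ≡
      2 * ∑ (allFin a) (λ x → ∑ (allFin b) (λ y → 𝟙 (support Z (inj₁ x)) * (𝟙 (support Z (inj₂ y)) * 𝟙 (E x y))))
    edges-support {Z} u = begin
      edges Z Z
        ≡⟨ ∑-cong Z (λ p → ∑-multiplicity Z (λ r → 𝟙 (biAdj E p r))) ⟩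
      ∑ Z (λ p → ∑ vertices (λ r → multiplicity Z r * 𝟙 (biAdj E p r)))
        ≡⟨ ∑-multiplicity Z _ ⟩
      ∑ vertices (λ p → multiplicity Z p * ∑ vertices (λ r → multiplicity Z r * 𝟙 (biAdj E p r)))
        ≡⟨ ∑-cong vertices (λ p → cong₂ _*_ (sym (𝟙-support u p))
             (∑-cong vertices λ r → cong (_* 𝟙 (biAdj E p r)) (sym (𝟙-support u r)))) ⟩
      ∑ vertices (λ p → 𝟙 (support Z p) * ∑ vertices (λ r → 𝟙 (support Z r) * 𝟙 (biAdj E p r)))
        ≡⟨ edges-weighted (λ r → 𝟙 (support Z r)) ⟩
      2 * ∑ (allFin a) (λ x → ∑ (allFin b) (λ y → 𝟙 (support Z (inj₁ x)) * (𝟙 (support Z (inj₂ y)) * 𝟙 (E x y)))) ∎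
      where open ≡-Reasoning

    edges-vertices : edges vertices vertices ≡ 2 * ∑ (allFin a) (λ x → ∑ (allFin b) (λ y → 𝟙 (E x y)))
    edges-vertices = trans
      (∑-cong vertices λ p → trans (∑-cong vertices λ r → sym (*-identityˡ _)) (sym (*-identityˡ _)))
      (trans (edges-weighted (λ _ → 1)) (cong (2 *_) (∑-cong (allFin a) λ x → ∑-cong (allFin b) λ y →
        trans (*-identityˡ _) (*-identityˡ _))))

-- The bipartite graph of a family of maps

module MapGraph {d m q : ℕ} (f : Fin d → Fin m → Fin q) where

  -- The right side consists of `d` blocks of size `q`, and `a` has exactly one neighbour, `f i a`,
  -- in block `i`. Whatever the maps, the number of edges is thus exactly `m * d`.
  E : Fin m → Fin (d * q) → Bool
  E a v = ⌊ f (quotient q v) a Fin.≟ remainder {d} q v ⌋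

  E-combine : ∀ a i y → 𝟙 (E a (combine i y)) ≡ δ (f i a) y
  E-combine a i y = cong (λ (iy : Fin d × Fin q) → 𝟙 ⌊ f (proj₁ iy) a Fin.≟ proj₂ iy ⌋) (Fin.remQuot-combine i y)

  ∑E : ∀ (φ : Fin (d * q) → ℕ) a →
    ∑ (allFin (d * q)) (λ v → φ v * 𝟙 (E a v)) ≡ ∑ (allFin d) (λ i → φ (combine i (f i a)))
  ∑E φ a = trans (∑-combine d _) (∑-cong (allFin d) λ i →
    trans (∑-cong (allFin q) λ y → trans (*-comm (φ (combine i y)) _) (cong (_* φ (combine i y)) (E-combine a i y)))
          (∑-δ (f i a) (λ y → φ (combine i y))))

  size : ∑ (allFin m) (λ a → ∑ (allFin (d * q)) (λ v → 𝟙 (E a v))) ≡ m * d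
  size = trans (∑-cong (allFin m) λ a → trans (∑-cong (allFin (d * q)) λ v → sym (*-identityˡ _))
           (trans (∑E (λ _ → 1) a) (trans (∑-constFin d 1) (*-identityʳ d)))) (∑-constFin m d)

  sparse-pair : ∀ (α : Fin m → ℕ) (β : Fin (d * q) → ℕ) →
    ∑ (allFin m) (λ a → ∑ (allFin (d * q)) (λ v → α a * (β v * 𝟙 (E a v))))
    ≡ ∑ (allFin d) (λ i → ∑ (allFin m) (λ a → α a * β (combine i (f i a))))
  sparse-pair α β = trans (∑-cong (allFin m) λ a → trans (∑-*ˡ (allFin (d * q)) (α a) _)
      (trans (cong (α a *_) (∑E β a)) (sym (∑-*ˡ (allFin d) (α a) _))))
    (∑-swap (allFin m) (allFin d) _)

path-in-sparse-graph : ∀ {a b} (E J : Fin a → Fin b → Bool) {K ℓ M} → ℓ ≤ K → 0 < K →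
  (∀ x y → J x y ≡ true → E x y ≡ true) →
  (∀ (α : Fin a → Bool) (β : Fin b → Bool) → ∑ (allFin a) (𝟙 ∘ α) ≤ 2 * K → ∑ (allFin b) (𝟙 ∘ β) ≤ 2 * K →
     ∑ (allFin a) (λ x → ∑ (allFin b) (λ y → 𝟙 (α x) * (𝟙 (β y) * 𝟙 (E x y)))) ≤ M) →
  M * (a + b + K) < K * ∑ (allFin a) (λ x → ∑ (allFin b) (λ y → 𝟙 (J x y))) →
  DepthFirst.Path (biAdj J) (biAdj-sym J) ℓ
path-in-sparse-graph {a} {b} E J {K} {ℓ} {M} ℓ≤K 0<K J⇒E sparse dense
  with path-or-few-edges ℓ≤K sparse′ 0<K (length (vertices {a} {b})) vertices vertices-unique ≤-refl
  where
  open DepthFirst (biAdj J) (biAdj-sym J)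
  -- `edges` counts ordered pairs, hence `2 * M`; the factor 2 cancels against the one in
  -- `edges-vertices`.
  sparse′ : ∀ Z → Unique Z → length Z ≤ 2 * K → edges Z Z ≤ 2 * M
  sparse′ Z u Z≤2K = ≤-trans (≤-reflexive (edges-support J u)) (*-monoʳ-≤ 2 (≤-trans
    (∑-mono (allFin a) λ x → ∑-mono (allFin b) λ y →
      *-monoʳ-≤ (𝟙 (support Z (inj₁ x))) (*-monoʳ-≤ (𝟙 (support Z (inj₂ y))) (𝟙-mono (J⇒E x y))))
    (sparse (support Z ∘ inj₁) (support Z ∘ inj₂)
      (≤-trans (m≤m+n _ _) (≤-trans (≤-reflexive (support-size u)) Z≤2K))
      (≤-trans (m≤n+m _ _) (≤-trans (≤-reflexive (support-size u)) Z≤2K)))))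
... | inj₁ path = path
... | inj₂ few = contradiction dense (≤⇒≯ (*-cancelˡ-≤ 2 (begin
  2 * (K * e)                                ≡⟨ exchange K e ⟩
  K * (2 * e)                                ≡⟨ cong (K *_) (edges-vertices J) ⟨
  K * edges vertices vertices                ≤⟨ few ⟩
  2 * M * (length (vertices {a} {b}) + K)    ≡⟨ cong (λ l → 2 * M * (l + K)) (length-vertices {a} {b}) ⟩
  2 * M * (a + b + K)                        ≡⟨ *-assoc 2 M _ ⟩
  2 * (M * (a + b + K))                      ∎)))
  where
  open DepthFirst (biAdj J) (biAdj-sym J)
  open ≤-Reasoning
  e = ∑ (allFin a) (λ x → ∑ (allFin b) (λ y → 𝟙 (J x y)))
  exchange : ∀ K e → 2 * (K * e) ≡ K * (2 * e)
  exchange = solve-∀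

-- The blow-up

∧-true : ∀ {a b} → a ∧ b ≡ true → a ≡ true × b ≡ true
∧-true {true} {true} refl = refl , refl

quotient-combine : ∀ {m n} (i : Fin m) (j : Fin n) → quotient n (combine i j) ≡ i
quotient-combine i j = cong proj₁ (Fin.remQuot-combine i j)

↑ˡ≢↑ʳ : ∀ {a b} {x : Fin a} {y : Fin b} → x ↑ˡ b ≢ a ↑ʳ y
↑ˡ≢↑ʳ {a} {b} {x} {y} eq with () ← trans (sym (Fin.splitAt-↑ˡ a x b)) (trans (cong (splitAt a) eq) (Fin.splitAt-↑ʳ a b y))

module BlowUp {a b : ℕ} (E : Fin a → Fin b → Bool) (r : ℕ) .{{_ : NonZero r}} where

  -- `p` is the inverse density that `pairing` leaves after the left pairs are chosen; the second
  -- use of `pairing` then asks for clusters of size `2 * p`.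
  p b₁ b₂ a′ b′ : ℕ
  p  = 2 * (r * r)
  b₁ = 2 * r
  b₂ = 2 * p
  a′ = a * b₁
  b′ = b * b₂

  instance
    p≢0 : NonZero p
    p≢0 = m*n≢0 2 (r * r) {{_}} {{m*n≢0 r r}}

  e : (Fin a → Fin b → Bool) → ℕ
  e J = ∑ (allFin a) (λ u → ∑ (allFin b) (λ v → 𝟙 (J u v)))

  -- The half-way graph, blown up on the right only. The left pairs are chosen relative to it.
  E₁ : Fin a → Fin b′ → Bool
  E₁ u z = E u (quotient b₂ z)

  e₁ : ℕ
  e₁ = ∑ (allFin a) (λ u → ∑ (allFin b′) (λ z → 𝟙 (E₁ u z)))

  G : Graph (a′ + b′)
  G = bipartiteGraph (λ x z → E₁ (quotient b₁ x) z)

  G-bipartite : Bipartite G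
  G-bipartite = bipartiteGraph-bipartite {a′} {b′} (λ x z → E₁ (quotient b₁ x) z)

  G-adj : ∀ u x z → adj G (combine u x ↑ˡ b′) (a′ ↑ʳ z) ≡ E₁ u z
  G-adj u x z = trans (cong₂ (biAdj _) (Fin.splitAt-↑ˡ a′ (combine u x) b′) (Fin.splitAt-↑ʳ a′ b′ z))
                      (cong (λ v → E₁ v z) (quotient-combine u x))

  e₁≡ : e₁ ≡ b₂ * e E
  e₁≡ = trans (∑-cong (allFin a) λ u → trans (∑-combine b _) (trans (∑-cong (allFin b) λ v →
          trans (∑-cong (allFin b₂) λ y → cong (𝟙 ∘ E u) (quotient-combine v y)) (∑-constFin b₂ (𝟙 (E u v))))
          (∑-*ˡ (allFin b) b₂ _))) (∑-*ˡ (allFin a) b₂ _)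

  edgeCount-split : ∀ J → J ⊆G G → edgeCount J ≡
    ∑ (allFin a) (λ u → ∑ (allFin b₁) (λ x → ∑ (allFin b′) (λ z → 𝟙 (adj J (combine u x ↑ˡ b′) (a′ ↑ʳ z)))))
  edgeCount-split J J⊆G = trans (edgeCount-bipartite {a′} {b′} _ J J⊆G)
    (∑-combine a {b₁} (λ i → ∑ (allFin b′) (λ z → 𝟙 (adj J (i ↑ˡ b′) (a′ ↑ʳ z)))))

  edgeCount-G₁ : edgeCount G ≡ b₁ * e₁
  edgeCount-G₁ = trans (edgeCount-split G (λ _ _ eq → eq))
    (trans (∑-cong (allFin a) λ u → trans (∑-cong (allFin b₁) λ x → ∑-cong (allFin b′) λ z → cong 𝟙 (G-adj u x z))
      (∑-constFin b₁ _)) (∑-*ˡ (allFin a) b₁ _))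

  edgeCount-G : edgeCount G ≡ b₁ * (b₂ * e E)
  edgeCount-G = trans edgeCount-G₁ (cong (b₁ *_) e₁≡)

  -- Every J of density 1/r contains, between suitable pairs of vertices chosen in the clusters,
  -- all four edges over a 1/(8r⁴) proportion of the edges of E.
  module _ (J : Graph (a′ + b′)) (J⊆G : J ⊆G G) where

    R : Fin a → Fin b₁ → Fin b′ → Bool
    R u x z = adj J (combine u x ↑ˡ b′) (a′ ↑ʳ z)

    R⇒E₁ : ∀ u x z → R u x z ≡ true → E₁ u z ≡ true
    R⇒E₁ u x z Ruxz = trans (sym (G-adj u x z)) (J⊆G _ _ Ruxz)

    module LeftPairs (x x′ : Fin a → Fin b₁) where

      R₂ : Fin b → Fin b₂ → Fin a → Bool
      R₂ v y u = R u (x u) (combine v y) ∧ R u (x′ u) (combine v y)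

      R₂⇒E : ∀ v y u → R₂ v y u ≡ true → E u v ≡ true
      R₂⇒E v y u both = trans (sym (cong (E u) (quotient-combine v y))) (R⇒E₁ u (x u) (combine v y) (proj₁ (∧-true both)))

      -- The outcome of the first averaging, regrouped by right clusters, is the density hypothesis
      -- of the second, with `p` in place of `r` and the sides exchanged.
      dense₂ : e₁ ≤ p * ∑ (allFin a) (λ u → ∑ (allFin b′) (λ z → 𝟙 (R u (x u) z ∧ R u (x′ u) z))) →
        b₂ * ∑ (allFin b) (λ v → ∑ (allFin a) (λ u → 𝟙 (E u v)))
        ≤ p * ∑ (allFin b) (λ v → ∑ (allFin b₂) (λ y → ∑ (allFin a) (λ u → 𝟙 (R₂ v y u))))
      dense₂ dense₁ = begin
        b₂ * ∑ (allFin b) (λ v → ∑ (allFin a) (λ u → 𝟙 (E u v)))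
          ≡⟨ cong (b₂ *_) (∑-swap (allFin b) (allFin a) (λ v u → 𝟙 (E u v))) ⟩
        b₂ * e E
          ≡⟨ e₁≡ ⟨
        e₁
          ≤⟨ dense₁ ⟩
        p * ∑ (allFin a) (λ u → ∑ (allFin b′) (λ z → 𝟙 (R u (x u) z ∧ R u (x′ u) z)))
          ≡⟨ cong (p *_) (trans (∑-cong (allFin a) λ u → ∑-combine b (λ z → 𝟙 (R u (x u) z ∧ R u (x′ u) z)))
               (trans (∑-swap (allFin a) (allFin b) (λ u v → ∑ (allFin b₂) (λ y → 𝟙 (R₂ v y u))))
               (∑-cong (allFin b) λ v → ∑-swap (allFin a) (allFin b₂) (λ u y → 𝟙 (R₂ v y u))))) ⟩
        p * ∑ (allFin b) (λ v → ∑ (allFin b₂) (λ y → ∑ (allFin a) (λ u → 𝟙 (R₂ v y u)))) ∎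
        where open ≤-Reasoning

      module RightPairs (y y′ : Fin b → Fin b₂) where

        J′ : Fin a → Fin b → Bool
        J′ u v = R₂ v (y v) u ∧ R₂ v (y′ v) u

        J′⇒E : ∀ u v → J′ u v ≡ true → E u v ≡ true
        J′⇒E u v eq = R₂⇒E v (y v) u (proj₁ (∧-true eq))

        lift : (Fin a → Fin b₁) → (Fin b → Fin b₂) → Fin a ⊎ Fin b → Fin (a′ + b′)
        lift x y (inj₁ u) = combine u (x u) ↑ˡ b′
        lift x y (inj₂ v) = a′ ↑ʳ combine v (y v)

        lift-inj : ∀ x y v w → lift x y v ≡ lift x y w → v ≡ w
        lift-inj x y (inj₁ u) (inj₁ u′) eq = cong inj₁ (Fin.combine-injectiveˡ u _ u′ _ (Fin.↑ˡ-injective b′ _ _ eq))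
        lift-inj x y (inj₂ v) (inj₂ v′) eq = cong inj₂ (Fin.combine-injectiveˡ v _ v′ _ (Fin.↑ʳ-injective a′ _ _ eq))
        lift-inj x y (inj₁ u) (inj₂ v)  eq = contradiction eq ↑ˡ≢↑ʳ
        lift-inj x y (inj₂ v) (inj₁ u)  eq = contradiction (sym eq) ↑ˡ≢↑ʳ

        lift-≢ : (∀ u → x u ≢ x′ u) → (∀ v → y v ≢ y′ v) → ∀ v w → lift x y v ≢ lift x′ y′ w
        lift-≢ x≢x′ y≢y′ (inj₁ u) (inj₁ u′) eq with Fin.combine-injective u _ u′ _ (Fin.↑ˡ-injective b′ _ _ eq)
        ... | refl , same = x≢x′ u same
        lift-≢ x≢x′ y≢y′ (inj₂ v) (inj₂ v′) eq with Fin.combine-injective v _ v′ _ (Fin.↑ʳ-injective a′ _ _ eq)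
        ... | refl , same = y≢y′ v same
        lift-≢ x≢x′ y≢y′ (inj₁ u) (inj₂ v)  eq = ↑ˡ≢↑ʳ eq
        lift-≢ x≢x′ y≢y′ (inj₂ v) (inj₁ u)  eq = ↑ˡ≢↑ʳ (sym eq)

        Complete : Fin a ⊎ Fin b → Fin a ⊎ Fin b → Set
        Complete v w = adj J (lift x y v) (lift x y w) ≡ true
                     × adj J (lift x′ y′ v) (lift x y w) ≡ true
                     × adj J (lift x′ y′ v) (lift x′ y′ w) ≡ true

        complete : ∀ v w → biAdj J′ v w ≡ true → Complete v w
        complete (inj₁ u) (inj₂ v) eq =
          let both , both′ = ∧-true eq
          in proj₁ (∧-true both) , proj₂ (∧-true both) , proj₂ (∧-true both′)
        complete (inj₂ v) (inj₁ u) eq =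
          let both , both′ = ∧-true eq
          in trans (Graph.sym J _ _) (proj₁ (∧-true both)) ,
             trans (Graph.sym J _ _) (proj₁ (∧-true both′)) ,
             trans (Graph.sym J _ _) (proj₂ (∧-true both′))

  arrows : ∀ k → 2 ≤ k →
    (∀ J → (∀ u v → J u v ≡ true → E u v ≡ true) → e E ≤ 2 * (p * p) * e J →
       DepthFirst.Path (biAdj J) (biAdj-sym J) (suc k)) →
    Arrows G r (2 * k)
  arrows k 2≤k path J J⊆G dense =
    let x , x′ , x≢x′ , dense₁ = pairing (allFin a) (allFin b′) r E₁ (R J J⊆G) (R⇒E₁ J J⊆G)
          (≤-trans (≤-reflexive (sym edgeCount-G₁))
            (≤-trans dense (≤-reflexive (cong (r *_) (edgeCount-split J J⊆G)))))
    in finish x x′ x≢x′ dense₁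
    where
    finish : ∀ x x′ → (∀ u → x u ≢ x′ u) →
      e₁ ≤ p * ∑ (allFin a) (λ u → ∑ (allFin b′) (λ z → 𝟙 (R J J⊆G u (x u) z ∧ R J J⊆G u (x′ u) z))) →
      ContainsCycle J (2 * k)
    finish x x′ x≢x′ dense₁ =
      let y , y′ , y≢y′ , dense₃ = pairing (allFin b) (allFin a) p (λ v u → E u v) R₂ R₂⇒E (dense₂ dense₁)
      in close y y′ y≢y′ dense₃
      where
      open LeftPairs J J⊆G x x′
      close : ∀ y y′ → (∀ v → y v ≢ y′ v) →
        ∑ (allFin b) (λ v → ∑ (allFin a) (λ u → 𝟙 (E u v)))
        ≤ 2 * (p * p) * ∑ (allFin b) (λ v → ∑ (allFin a) (λ u → 𝟙 (R₂ v (y v) u ∧ R₂ v (y′ v) u))) →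
        ContainsCycle J (2 * k)
      close y y′ y≢y′ dense₃ =
        doubled-path⇒cycle J (biAdj J′) (biAdj-sym J′) (lift x y) (lift x′ y′)
          (λ {v} {w} → lift-inj x y v w) (λ {v} {w} → lift-inj x′ y′ v w) (λ {v} {w} → lift-≢ x≢x′ y≢y′ v w)
          (λ v w vw → proj₁ (complete v w vw)) (λ v w vw → proj₁ (proj₂ (complete v w vw)))
          (λ v w vw → proj₂ (proj₂ (complete v w vw)))
          k 2≤k (path J′ J′⇒E (≤-trans (≤-reflexive (∑-swap (allFin a) (allFin b) (λ u v → 𝟙 (E u v))))
            (≤-trans dense₃ (≤-reflexive (cong (2 * (p * p) *_) (∑-swap (allFin b) (allFin a) (λ v u → 𝟙 (J′ u v))))))))
        where open RightPairs y y′

-- Choice of the constants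

module Parameters (r k : ℕ) .{{_ : NonZero r}} (2≤k : 2 ≤ k) where
  -- `R = 8r⁴` is the inverse density after both averaging steps. Under random maps, `2K` left and
  -- `2K` right vertices span `4K²/(2k) = 2c²k` edges on average, and `Q` is twice this. The union
  -- bound adds `m + d(2k) = 4dk`, which `d = c²` keeps comparable, so `M = 8dk`. Peeling takes
  -- about `4d/c` rounds and accounts for about `32d²k/c` edges, against `2d²k/R` in a dense
  -- subgraph. Hence `c` must exceed `16R`; 20 leaves room for the last batch.
  R c d K m Q M : ℕ
  R = 2 * (2 * (r * r) * (2 * (r * r)))
  c = 20 * R
  d = c * c
  K = c * k
  m = d * (2 * k)
  Q = 4 * (d * k)
  M = m + d * (2 * k) + Q

  instance
    k≢0 : NonZero k
    k≢0 = >-nonZero (≤-trans (s≤s z≤n) 2≤k)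
    R≢0 : NonZero R
    R≢0 = m*n≢0 2 _ {{_}} {{m*n≢0 (2 * (r * r)) (2 * (r * r)) {{rr}} {{rr}}}}
      where
      rr : NonZero (2 * (r * r))
      rr = m*n≢0 2 (r * r) {{_}} {{m*n≢0 r r}}

    c≢0 : NonZero c
    c≢0 = m*n≢0 20 R
    d≢0 : NonZero d
    d≢0 = m*n≢0 c c

  2≤c : 2 ≤ c
  2≤c = ≤-trans (s≤s (s≤s z≤n)) (m≤m*n 20 R)

  c<d : c < d
  c<d = ≤-trans (≤-reflexive (cong suc (sym (*-identityʳ c)))) (*-monoʳ-< c 2≤c)

  1+k≤K : suc k ≤ K
  1+k≤K = ≤-trans (+-monoˡ-≤ k (≤-trans (s≤s z≤n) 2≤k))
    (≤-trans (≤-reflexive (cong (k +_) (sym (+-identityʳ k)))) (*-monoˡ-≤ k 2≤c))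

  4K²≤kQ : 2 * K * (2 * K) ≤ k * Q
  4K²≤kQ = ≤-reflexive (identity c k)
    where
    identity : ∀ c k → 2 * (c * k) * (2 * (c * k)) ≡ k * (4 * (c * c * k))
    identity = solve-∀

  -- R · M (2m + K) = 8Rdk² (4d + c), while K · md = 8Rdk² · 5d because c = 20R.
  few<many : ∀ j → m * d ≤ R * j → M * (m + d * (2 * k) + K) < K * j
  few<many j dense = *-cancelˡ-< R _ _ (begin-strict
    R * (M * (m + d * (2 * k) + K))          ≡⟨ lhs R c d k ⟩
    8 * (R * d * (k * k)) * (4 * d + c)      <⟨ *-monoʳ-< (8 * (R * d * (k * k))) {{N}} (+-monoʳ-< (4 * d) c<d) ⟩
    8 * (R * d * (k * k)) * (4 * d + d)      ≡⟨ rhs R d k ⟩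
    K * (m * d)                              ≤⟨ *-monoʳ-≤ K dense ⟩
    K * (R * j)                              ≡⟨ exchange K R j ⟩
    R * (K * j)                              ∎)
    where
    open ≤-Reasoning
    N : NonZero (8 * (R * d * (k * k)))
    N = m*n≢0 8 _ {{_}} {{m*n≢0 (R * d) (k * k) {{m*n≢0 R d}} {{m*n≢0 k k}}}}
    lhs : ∀ R c d k → R * ((d * (2 * k) + d * (2 * k) + 4 * (d * k)) * (d * (2 * k) + d * (2 * k) + c * k))
                    ≡ 8 * (R * d * (k * k)) * (4 * d + c)
    lhs = solve-∀
    rhs : ∀ R d k → 8 * (R * d * (k * k)) * (4 * d + d) ≡ 20 * R * k * (d * (2 * k) * d)
    rhs = solve-∀
    exchange : ∀ a b c → a * (b * c) ≡ b * (a * c)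
    exchange = solve-∀

  -- The exponent is `3 + 16`: the clusters contribute `2r * 4r² = 8r³`, and `m * d` is
  -- `c ^ 4 * (2 * k)` with `c = 160r⁴`.
  total-edges : 2 * r * (2 * (2 * (r * r)) * (m * d)) ≡ 8 * 160 ^ 4 * r ^ 19 * (2 * k)
  total-edges = begin
    2 * r * (2 * (2 * (r * r)) * (m * d))          ≡⟨ expand r c k ⟩
    8 * c ^ 4 * r ^ 3 * (2 * k)                    ≡⟨ cong (λ z → 8 * z ^ 4 * r ^ 3 * (2 * k)) (c≡ r) ⟩
    8 * (160 * r ^ 4) ^ 4 * r ^ 3 * (2 * k)        ≡⟨ cong (λ z → 8 * z * r ^ 3 * (2 * k)) (^-distrib-* 160 (r ^ 4) 4) ⟩
    8 * (160 ^ 4 * (r ^ 4) ^ 4) * r ^ 3 * (2 * k)  ≡⟨ cong (λ z → 8 * (160 ^ 4 * z) * r ^ 3 * (2 * k)) (^-*-assoc r 4 4) ⟩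
    8 * (160 ^ 4 * r ^ 16) * r ^ 3 * (2 * k)       ≡⟨ regroup (160 ^ 4) (r ^ 16) (r ^ 3) (2 * k) ⟩
    8 * 160 ^ 4 * (r ^ 16 * r ^ 3) * (2 * k)       ≡⟨ cong (λ z → 8 * 160 ^ 4 * z * (2 * k)) (^-distribˡ-+-* r 16 3) ⟨
    8 * 160 ^ 4 * r ^ 19 * (2 * k)                 ∎
    where
    open ≡-Reasoning
    expand : ∀ r c k → 2 * r * (2 * (2 * (r * r)) * (c * c * (2 * k) * (c * c))) ≡ 8 * (c * (c * (c * (c * 1)))) * (r * (r * (r * 1))) * (2 * k)
    expand = solve-∀
    c≡ : ∀ r → 20 * (2 * (2 * (r * r) * (2 * (r * r)))) ≡ 160 * (r * (r * (r * (r * 1))))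
    c≡ = solve-∀
    regroup : ∀ x y z w → 8 * (x * y) * z * w ≡ 8 * x * (y * z) * w
    regroup = solve-∀

theorem3p4 : ∃[ C ] (∀ (r : ℕ) → 2 ≤ r → ∃[ n₀ ] (∀ (n : ℕ) → n₀ ≤ n → 2 ∣ n →
    ∃[ m ] Σ (Graph m) λ G →
    Bipartite G ×
    edgeCount G ≤ C * (r ^ 120) * (⌊log₂ r ⌋ ^ 2) * n ×
    Arrows G r n))
-- The threshold 4 ensures `2 ≤ k`: a doubled path with a single edge would close up after two
-- vertices.
theorem3p4 = 8 * 160 ^ 4 , λ r 2≤r → 4 , λ n 4≤n 2∣n → even r 2≤r n 4≤n 2∣n
  where
  even : ∀ r → 2 ≤ r → ∀ n → 4 ≤ n → 2 ∣ n → ∃[ m ] Σ (Graph m) λ G →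
    Bipartite G × edgeCount G ≤ 8 * 160 ^ 4 * (r ^ 120) * (⌊log₂ r ⌋ ^ 2) * n × Arrows G r n
  even r 2≤r n 4≤n (divides k n≡k*2) =
    _ , G , G-bipartite , size-bound , subst (Arrows G r) (sym n≡2k) (arrows k 2≤k long-path)
    where
    instance
      r≢0 : NonZero r
      r≢0 = >-nonZero (≤-trans (s≤s z≤n) 2≤r)
    n≡2k : n ≡ 2 * k
    n≡2k = trans n≡k*2 (*-comm k 2)
    2≤k : 2 ≤ k
    2≤k = *-cancelˡ-≤ 2 (≤-trans 4≤n (≤-reflexive n≡2k))
    open Parameters r k 2≤k

    chosen = sparse-map d m k Q (2 * K) 4K²≤kQ
    open MapGraph (proj₁ chosen) using (E; size; sparse-pair)
    open BlowUp E r using (G; G-bipartite; edgeCount-G; arrows; e)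

    long-path : ∀ J → (∀ u v → J u v ≡ true → E u v ≡ true) → e E ≤ R * e J →
                DepthFirst.Path (biAdj J) (biAdj-sym J) (suc k)
    long-path J J⇒E dense = path-in-sparse-graph E J 1+k≤K (≤-trans (s≤s z≤n) 1+k≤K) J⇒E
      (λ α β α≤ β≤ → ≤-trans (≤-reflexive (sparse-pair (𝟙 ∘ α) (𝟙 ∘ β))) (proj₂ chosen α β α≤ β≤))
      (few<many (e J) (≤-trans (≤-reflexive (sym size)) dense))

    open ≤-Reasoning
    1≤log : 1 ≤ ⌊log₂ r ⌋ ^ 2
    1≤log = ^-monoˡ-≤ 2 (⌊log₂⌋-mono-≤ 2≤r)
    size-bound : edgeCount G ≤ 8 * 160 ^ 4 * (r ^ 120) * (⌊log₂ r ⌋ ^ 2) * n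
    size-bound = begin
      edgeCount G
        ≡⟨ edgeCount-G ⟩
      2 * r * (2 * (2 * (r * r)) * e E)
        ≡⟨ cong (λ z → 2 * r * (2 * (2 * (r * r)) * z)) size ⟩
      2 * r * (2 * (2 * (r * r)) * (m * d))
        ≡⟨ total-edges ⟩
      8 * 160 ^ 4 * r ^ 19 * (2 * k)
        ≡⟨ cong (8 * 160 ^ 4 * r ^ 19 *_) n≡2k ⟨
      8 * 160 ^ 4 * r ^ 19 * n
        ≤⟨ *-monoˡ-≤ n (*-monoʳ-≤ (8 * 160 ^ 4) (^-monoʳ-≤ r (m≤m+n 19 101))) ⟩
      8 * 160 ^ 4 * r ^ 120 * n
        ≡⟨ cong (_* n) (*-identityʳ (8 * 160 ^ 4 * r ^ 120)) ⟨
      8 * 160 ^ 4 * r ^ 120 * 1 * n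
        ≤⟨ *-monoˡ-≤ n (*-monoʳ-≤ (8 * 160 ^ 4 * r ^ 120) 1≤log) ⟩
      8 * 160 ^ 4 * (r ^ 120) * (⌊log₂ r ⌋ ^ 2) * n ∎
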